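{- There exists an absolute constant $C>0$ such that the following holds. Let $\varepsilon>0$, let $t\geq1$ be an integer, and let $n\geq 2^{Ct/\varepsilon^{16}}$. Then every locally $\varepsilon$-balanced $2$-edge-coloured (red/blue) $K_n$ contains one of the following: (i) two disjoint vertex sets $A,B$ of size $t$ such that, for some colour $c$, all edges inside $A$ and inside $B$ have colour $c$ and all edges between $A$ and $B$ have the other colour; (ii) four disjoint vertex sets $V_1,V_2,V_3,V_4$ of size $t$ such that all edges inside $V_1$, inside $V_4$, between $V_1$ and $V_3$, between $V_1$ and $V_4$, and between $V_2$ and $V_4$ are red, while all edges inside $V_2$, inside $V_3$, between $V_1$ and $V_2$, between $V_2$ and $V_3$, and between $V_3$ and $V_4$ are blue.
   Context: A $2$-edge-coloured $K_n$ is called locally $\varepsilon$-balanced if every vertex is incident to at least $\varepsilon n$ red edges and at least $\varepsilon n$ blue edges. -}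

module Defs where

open import Data.Fin using (Fin; _≟_)
open import Data.Fin.Subset using (Subset; _∈_; _∩_; Empty; ∣_∣)
open import Data.Integer using (+_)
open import Data.List using (length; filter; allFin)
open import Data.Nat as ℕ using (ℕ; NonZero)
open import Data.Product using (∃-syntax; _×_)
open import Data.Rational as ℚ using (ℚ; 0ℚ; _/_)
open import Data.Sum using (_⊎_)
open import Function.Bundles using (_⇔_)
open import Level using (0ℓ)
open import Relation.Binary.Definitions using (DecidableEquality)
open import Relation.Binary.PropositionalEquality using (_≡_; _≢_; refl)
open import Relation.Nullary using (¬_; yes; no; ¬?; _×-dec_)
open import Relation.Unary using (Pred)

open import Algebra.Definitions.RawSemiring ℚ.+-*-rawSemiring using (_^_)

-- Real numbers as two-sided Dedekind cuts: lower q means q < x, and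
-- upper q means x < q.
record ℝ : Set₁ where
  field
    lower upper     : Pred ℚ 0ℓ
    lower-inhabited : ∃[ q ] lower q
    upper-inhabited : ∃[ q ] upper q
    lower-rounded   : ∀ q → lower q ⇔ (∃[ r ] (q ℚ.< r × lower r))
    upper-rounded   : ∀ q → upper q ⇔ (∃[ r ] (r ℚ.< q × upper r))
    disjoint        : ∀ q → ¬ (lower q × upper q)
    located         : ∀ q r → q ℚ.< r → lower q ⊎ upper r

infix 4 _·_≤ℕ_ 2^_≤_

open ℝ public

Positive : ℝ → Set
Positive x = lower x 0ℚ

fromℕ : ℕ → ℚ
fromℕ n = + n / 1

-- x · n ≤ d.  As n ≥ 0, the real x · n is at most d exactly when q · n ≤ d
-- for every rational q < x.
_·_≤ℕ_ : ℝ → ℕ → ℕ → Set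
x · n ≤ℕ d = ∀ q → lower x q → q ℚ.* fromℕ n ℚ.≤ fromℕ d

-- The lower cut of the real number C t / ε¹⁶, for C, ε > 0: the rational q
-- lies below it iff q < c t / e¹⁶ for some rationals c < C and e > ε when
-- t ≥ 1 (for t = 0 both sides say q < 0).  Division by e¹⁶ is cleared.
Ct/ε¹⁶ : ℝ → ℕ → ℝ → Pred ℚ 0ℓ
Ct/ε¹⁶ C t ε q =
  ∃[ c ] ∃[ e ] (lower C c × upper ε e × q ℚ.* e ^ 16 ℚ.< c ℚ.* fromℕ t)

-- 2 ^ x ≤ n for a real x > 0 given by its lower cut X.  The real power 2 ^ x is
-- the supremum of 2 ^ (a / b) over the rationals 0 ≤ a / b < x, and
-- 2 ^ (a / b) ≤ n iff 2 ^ a ≤ n ^ b.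
2^_≤_ : Pred ℚ 0ℓ → ℕ → Set
2^ X ≤ n = ∀ (a b : ℕ) .{{_ : NonZero b}} → X (+ a / b) → 2 ℕ.^ a ℕ.≤ n ℕ.^ b

data Colour : Set where
  red blue : Colour

other : Colour → Colour
other red  = blue
other blue = red

_≟ᶜ_ : DecidableEquality Colour
red  ≟ᶜ red  = yes refl
red  ≟ᶜ blue = no λ ()
blue ≟ᶜ red  = no λ ()
blue ≟ᶜ blue = yes refl

-- A red/blue colouring of the edges of Kₙ.  The diagonal values colour u u are
-- meaningless and every definition below ignores them.
record Colouring (n : ℕ) : Set where
  field
    colour    : Fin n → Fin n → Colour
    symmetric : ∀ u v → colour u v ≡ colour v u

open Colouring public

Disjoint : ∀ {n} → Subset n → Subset n → Set
Disjoint A B = Empty (A ∩ B)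

module _ {n : ℕ} (K : Colouring n) where

  degree : Colour → Fin n → ℕ
  degree c u =
    length (filter (λ v → ¬? (u ≟ v) ×-dec (colour K u v ≟ᶜ c)) (allFin n))

  LocallyBalanced : ℝ → Set
  LocallyBalanced ε = ∀ u c → ε · n ≤ℕ degree c u

  Inside : Subset n → Colour → Set
  Inside A c = ∀ {u v} → u ∈ A → v ∈ A → u ≢ v → colour K u v ≡ c

  Between : Subset n → Subset n → Colour → Set
  Between A B c = ∀ {u v} → u ∈ A → v ∈ B → colour K u v ≡ c

  record TwoSetPattern (t : ℕ) : Set where
    field
      A B       : Subset n
      ∣A∣≡t     : ∣ A ∣ ≡ t
      ∣B∣≡t     : ∣ B ∣ ≡ t
      A-B       : Disjoint A B
      c         : Colour
      inside-A  : Inside A c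
      inside-B  : Inside B c
      between   : Between A B (other c)

  record FourSetPattern (t : ℕ) : Set where
    field
      V₁ V₂ V₃ V₄ : Subset n
      ∣V₁∣≡t      : ∣ V₁ ∣ ≡ t
      ∣V₂∣≡t      : ∣ V₂ ∣ ≡ t
      ∣V₃∣≡t      : ∣ V₃ ∣ ≡ t
      ∣V₄∣≡t      : ∣ V₄ ∣ ≡ t
      disjoint₁₂  : Disjoint V₁ V₂
      disjoint₁₃  : Disjoint V₁ V₃
      disjoint₁₄  : Disjoint V₁ V₄
      disjoint₂₃  : Disjoint V₂ V₃
      disjoint₂₄  : Disjoint V₂ V₄
      disjoint₃₄  : Disjoint V₃ V₄
      inside₁     : Inside V₁ red
      inside₄     : Inside V₄ red
      between₁₃   : Between V₁ V₃ red
      between₁₄   : Between V₁ V₄ red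
      between₂₄   : Between V₂ V₄ red
      inside₂     : Inside V₂ blue
      inside₃     : Inside V₃ blue
      between₁₂   : Between V₁ V₂ blue
      between₂₃   : Between V₂ V₃ blue
      between₃₄   : Between V₃ V₄ blue

{-# OPTIONS --safe #-}

-- Some pairs (x, y) are "twisted": both N_red(x) ∖ N_red(y) and N_red(y) ∖ N_red(x)
-- have linear size.  Indeed, if x has low and y has high red degree the second
-- difference is at least as large as the first, and averaging over y the first
-- is large because every vertex of N_red(x) has many blue neighbours.
--
-- A clique of size m = O(log n) splits any vertex set of size n^(1 - o(1)) into
-- at most 2^m classes according to the colours of the edges to the clique, so by
-- averaging a constant proportion of the clique is joined in one prescribed
-- colour to n^(1 - o(1)) vertices, among which Ramsey's theorem yields a new
-- clique.  Starting from a clique of low red degree, this produces cliques X and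
-- Y all of whose pairs are twisted, then A and B such that X A Y B is an
-- alternating 4-cycle of monochromatic cliques whose diagonals are also
-- monochromatic.  Any such cycle contains one of the two patterns.
module Submission where

open import Defs
open import Algebra.Bundles using (CommutativeRing)
open import Data.Bool using (Bool; true; false; _∧_; not; T)
import Data.Bool.Properties as Bool
open import Data.Fin using (Fin; zero; suc) renaming (_≟_ to _≟ᶠ_)
open import Data.Fin.Properties using (suc-injective)
open import Data.Fin.Subset as Subset using (Subset; inside; outside; ∣_∣)
open import Data.Fin.Subset.Properties using (x∈p∩q⁻; ∉⊥; ∣⊥∣≡0)
open import Data.Integer as ℤ using ()
import Data.Integer.Properties as ℤ
open import Data.List using (List; []; _∷_; length; filter; take; allFin; tabulate)
open import Data.List.Membership.Propositional using (_∈_)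
open import Data.List.Membership.Propositional.Properties using (∈-filter⁻)
open import Data.List.Properties using (length-take; length-tabulate)
open import Data.List.Relation.Binary.Sublist.Propositional
  using (_⊆_; ⊆-refl; ⊆-trans; minimum; []; _∷_; _∷ʳ_) renaming (lookup to ⊆-lookup)
open import Data.List.Relation.Binary.Sublist.Propositional.Properties
  using (filter-⊆; take-⊆; All-resp-⊆; length-mono-≤)
open import Data.List.Relation.Unary.All as All using ([]; _∷_)
open import Data.List.Relation.Unary.AllPairs as AllPairs using (AllPairs; []; _∷_)
open import Data.List.Relation.Unary.Any using (here; there)
open import Data.List.Relation.Unary.Unique.Propositional using (Unique)
open import Data.List.Relation.Unary.Unique.Propositional.Properties using (allFin⁺)
open import Data.Nat
open import Data.Nat.Properties hiding (suc-injective)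
open import Data.Nat.Tactic.RingSolver using (solve-∀)
open import Data.Product using (∃-syntax; _×_; _,_; proj₁; proj₂)
open import Data.Rational as ℚ using (ℚ; mkℚ; 0ℚ; 1ℚ)
import Data.Rational.Properties as ℚ
open import Data.Rational.Unnormalised as ℚᵘ using (mkℚᵘ; *≤*)
import Data.Rational.Unnormalised.Properties as ℚᵘ
open import Data.Sum using (_⊎_; inj₁; inj₂; [_,_]′)
open import Data.Unit using (tt)
open import Data.Vec using (_[_]≔_; here; there; []; _∷_)
open import Function using (_∘_; flip; mk⇔)
open import Function.Bundles using (Equivalence)
open import Level using (0ℓ)
open import Relation.Binary.Core using (Rel)
open import Relation.Binary.PropositionalEquality
open import Relation.Nullary using (¬_; contradiction; yes; no; does)
open import Relation.Unary using (Decidable)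

open import Algebra.Definitions.RawSemiring ℚ.+-*-rawSemiring using () renaming (_^_ to _^ℚ_)
open import Algebra.Properties.CommutativeSemiring.Exp
  (CommutativeRing.commutativeSemiring ℚ.+-*-commutativeRing) using (^-distrib-*)

-- Counting by double sums

private variable
  A B C : Set

∑ : List A → (A → ℕ) → ℕ
∑ []       f = 0
∑ (x ∷ xs) f = f x + ∑ xs f

∑-mono : ∀ (xs : List A) {f g : A → ℕ} → (∀ {x} → x ∈ xs → f x ≤ g x) → ∑ xs f ≤ ∑ xs g
∑-mono []       f≤g = z≤n
∑-mono (x ∷ xs) f≤g = +-mono-≤ (f≤g (here refl)) (∑-mono xs (f≤g ∘ there))

∑-cong : ∀ (xs : List A) {f g : A → ℕ} → (∀ x → f x ≡ g x) → ∑ xs f ≡ ∑ xs g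
∑-cong []       f≡g = refl
∑-cong (x ∷ xs) f≡g = cong₂ _+_ (f≡g x) (∑-cong xs f≡g)

∑-+ : ∀ (xs : List A) (f g : A → ℕ) → ∑ xs (λ x → f x + g x) ≡ ∑ xs f + ∑ xs g
∑-+ []       f g = refl
∑-+ (x ∷ xs) f g rewrite ∑-+ xs f g = lemma (f x) (g x) (∑ xs f) (∑ xs g)
  where
  lemma : ∀ a b c d → a + b + (c + d) ≡ a + c + (b + d)
  lemma = solve-∀

∑-*ˡ : ∀ k (xs : List A) (f : A → ℕ) → ∑ xs (λ x → k * f x) ≡ k * ∑ xs f
∑-*ˡ k []       f = sym (*-zeroʳ k)
∑-*ˡ k (x ∷ xs) f rewrite ∑-*ˡ k xs f = sym (*-distribˡ-+ k (f x) _)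

∑-*ʳ : ∀ k (xs : List A) (f : A → ℕ) → ∑ xs (λ x → f x * k) ≡ ∑ xs f * k
∑-*ʳ k []       f = refl
∑-*ʳ k (x ∷ xs) f rewrite ∑-*ʳ k xs f = sym (*-distribʳ-+ k (f x) _)

∑-const : ∀ (xs : List A) k → ∑ xs (λ _ → k) ≡ length xs * k
∑-const []       k = refl
∑-const (x ∷ xs) k = cong (k +_) (∑-const xs k)

∑-swap : ∀ (xs : List A) (ys : List B) (f : A → B → ℕ) →
         ∑ xs (λ x → ∑ ys (f x)) ≡ ∑ ys (λ y → ∑ xs (λ x → f x y))
∑-swap []       ys f = trans (sym (*-zeroʳ (length ys))) (sym (∑-const ys 0))
∑-swap (x ∷ xs) ys f rewrite ∑-swap xs ys f = sym (∑-+ ys (f x) _)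

𝟙 : Bool → ℕ
𝟙 true  = 1
𝟙 false = 0

𝟙≤1 : ∀ b → 𝟙 b ≤ 1
𝟙≤1 true  = s≤s z≤n
𝟙≤1 false = z≤n

𝟙-∧ : ∀ a b → 𝟙 (a ∧ b) ≡ 𝟙 a * 𝟙 b
𝟙-∧ true  b = sym (+-identityʳ (𝟙 b))
𝟙-∧ false b = refl

# : List A → (A → Bool) → ℕ
# xs p = ∑ xs (𝟙 ∘ p)

select : (A → Bool) → List A → List A
select p = filter (λ x → p x Bool.≟ true)

length-select : ∀ (p : A → Bool) xs → length (select p xs) ≡ # xs p
length-select p []       = refl
length-select p (x ∷ xs) with p x
... | true  = cong suc (length-select p xs)
... | false = length-select p xs

∈-select⁻ : ∀ (p : A → Bool) xs {x} → x ∈ select p xs → p x ≡ true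
∈-select⁻ p xs x∈ = proj₂ (∈-filter⁻ (λ x → p x Bool.≟ true) {xs = xs} x∈)

select-⊆ : ∀ (p : A → Bool) xs → select p xs ⊆ xs
select-⊆ p = filter-⊆ (λ x → p x Bool.≟ true)

#-≤-length : ∀ (xs : List A) p → # xs p ≤ length xs
#-≤-length xs p = ≤-trans (∑-mono xs (λ {x} _ → 𝟙≤1 (p x)))
  (≤-reflexive (trans (∑-const xs 1) (*-identityʳ _)))

#-complement : ∀ (xs : List A) p → # xs p + # xs (not ∘ p) ≡ length xs
#-complement []       p = refl
#-complement (x ∷ xs) p with p x
... | true  = cong suc (#-complement xs p)
... | false = trans (+-suc (# xs p) _) (cong suc (#-complement xs p))

nonempty : ∀ (xs : List A) → 0 < length xs → ∃[ x ] x ∈ xs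
nonempty (x ∷ _) _ = x , here refl

0<*⇒0<ʳ : ∀ m n → 0 < m * n → 0 < n
0<*⇒0<ʳ m zero    0<mn = subst (0 <_) (*-zeroʳ m) 0<mn
0<*⇒0<ʳ m (suc n) _    = z<s

≤ᵇ-true : ∀ m n → (m ≤ᵇ n) ≡ true → m ≤ n
≤ᵇ-true m n eq = ≤ᵇ⇒≤ m n (subst T (sym eq) tt)

≤ᵇ-false : ∀ m n → (m ≤ᵇ n) ≡ false → n < m
≤ᵇ-false m n eq = ≰⇒> λ m≤n → subst T eq (≤⇒≤ᵇ m≤n)

-- A reverse Markov inequality. The hypothesis says that `2 * K * f y` sums to at least `2 * N * b`,
-- where `N` is the length of `ys`. Each y failing the test contributes less than `b`, together at
-- most `N * b`, so the good ones, contributing at most `2 * K * b` each, must supply the other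
-- `N * b`.
markov : ∀ (ys : List A) (f : A → ℕ) b K → 0 < b → (∀ y → f y ≤ b) →
         length ys * b ≤ K * ∑ ys f →
         length ys ≤ 2 * K * # ys (λ y → b ≤ᵇ 2 * K * f y)
markov ys f b@(suc _) K _ f≤b Nb≤KΣf = *-cancelʳ-≤ N (k * g) b (+-cancelʳ-≤ (N * b) (N * b) (k * g * b) (begin
  N * b + N * b                                  ≡⟨ double (N * b) ⟩
  2 * (N * b)                                    ≤⟨ *-monoʳ-≤ 2 Nb≤KΣf ⟩
  2 * (K * ∑ ys f)                               ≡⟨ *-assoc 2 K (∑ ys f) ⟨
  k * ∑ ys f                                     ≡⟨ ∑-*ˡ k ys f ⟨
  ∑ ys (λ y → k * f y)                           ≤⟨ ∑-mono ys (λ {y} _ → bound y) ⟩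
  ∑ ys (λ y → k * b * 𝟙 (good y) + b)            ≡⟨ ∑-+ ys _ _ ⟩
  ∑ ys (λ y → k * b * 𝟙 (good y)) + ∑ ys (λ _ → b) ≡⟨ cong₂ _+_ (∑-*ˡ (k * b) ys _) (∑-const ys b) ⟩
  k * b * g + N * b                              ≡⟨ cong (_+ N * b) (swap-last k b g) ⟩
  k * g * b + N * b                              ∎))
  where
  open ≤-Reasoning
  N k : ℕ
  N = length ys
  k = 2 * K
  good : _ → Bool
  good y = b ≤ᵇ k * f y
  g : ℕ
  g = # ys good
  double : ∀ x → x + x ≡ 2 * x
  double = solve-∀
  swap-last : ∀ x y z → x * y * z ≡ x * z * y
  swap-last = solve-∀
  bound : ∀ y → k * f y ≤ k * b * 𝟙 (good y) + b
  bound y with b ≤ᵇ k * f y in eq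
  ... | true  = ≤-trans (*-monoʳ-≤ k (f≤b y))
                  (≤-trans (≤-reflexive (sym (*-identityʳ (k * b)))) (m≤m+n _ b))
  ... | false = ≤-trans (<⇒≤ (≤ᵇ-false b (k * f y) eq)) (m≤n+m b (k * b * 0))

-- Complete and constant pairs in bipartite relations.

majority : ∀ (p : A → Bool) xs →
           ∃[ ys ] ∃[ c ] (ys ⊆ xs × length xs ≤ 2 * length ys × (∀ {y} → y ∈ ys → p y ≡ c))
majority p xs with ≤-total (# xs p) (# xs (not ∘ p))
... | inj₁ p≤¬p = select (not ∘ p) xs , false , select-⊆ _ xs , size , λ y∈ → not-true (∈-select⁻ (not ∘ p) xs y∈)
  where
  open ≤-Reasoning
  not-true : ∀ {b} → not b ≡ true → b ≡ false
  not-true {false} _ = refl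
  size : length xs ≤ 2 * length (select (not ∘ p) xs)
  size = begin
    length xs                         ≡⟨ #-complement xs p ⟨
    # xs p + # xs (not ∘ p)           ≤⟨ +-mono-≤ p≤¬p (≤-reflexive (sym (+-identityʳ _))) ⟩
    2 * # xs (not ∘ p)                ≡⟨ cong (2 *_) (length-select _ xs) ⟨
    2 * length (select (not ∘ p) xs)  ∎
... | inj₂ ¬p≤p = select p xs , true , select-⊆ _ xs , size , ∈-select⁻ p xs
  where
  open ≤-Reasoning
  size : length xs ≤ 2 * length (select p xs)
  size = begin
    length xs                         ≡⟨ #-complement xs p ⟨
    # xs p + # xs (not ∘ p)           ≤⟨ +-monoʳ-≤ (# xs p) (≤-trans ¬p≤p (≤-reflexive (sym (+-identityʳ _)))) ⟩
    2 * # xs p                        ≡⟨ cong (2 *_) (length-select p xs) ⟨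
    2 * length (select p xs)          ∎

-- Keeping, for one x after another, the larger half of the vs.
homogenise : ∀ (xs : List A) (vs : List C) (r : A → C → Bool) →
             ∃[ ws ] (ws ⊆ vs × length vs ≤ 2 ^ length xs * length ws ×
                      (∀ {x v w} → x ∈ xs → v ∈ ws → w ∈ ws → r x v ≡ r x w))
homogenise []       vs r = vs , ⊆-refl , ≤-reflexive (sym (+-identityʳ _)) , λ ()
homogenise (x ∷ xs) vs r with majority (r x) vs
... | us , c , us⊆vs , vs≤us , const-x with homogenise xs us r
...   | ws , ws⊆us , us≤ws , const-xs =
  ws , ⊆-trans ws⊆us us⊆vs , size , λ where
    (here refl) v∈ w∈ → trans (const-x (⊆-lookup ws⊆us v∈)) (sym (const-x (⊆-lookup ws⊆us w∈)))
    (there x∈)  v∈ w∈ → const-xs x∈ v∈ w∈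
  where
  open ≤-Reasoning
  size : length vs ≤ 2 ^ suc (length xs) * length ws
  size = begin
    length vs                               ≤⟨ vs≤us ⟩
    2 * length us                           ≤⟨ *-monoʳ-≤ 2 us≤ws ⟩
    2 * (2 ^ length xs * length ws)         ≡⟨ *-assoc 2 (2 ^ length xs) _ ⟨
    2 ^ suc (length xs) * length ws         ∎

-- After homogenising, every x sees all of `ws` in one way, so a single `w₀` in `ws` reveals the
-- value at each x, and a majority vote over the xs fixes it. Only a factor 2 is lost in `xs`; the
-- factor `2 ^ length xs` lost in `vs` is affordable when `xs` has logarithmic size.
monochromatic-pair :
  ∀ (xs : List A) (vs : List C) (r : A → C → Bool) → 0 < length vs →
  ∃[ ys ] ∃[ ws ] ∃[ c ]
    (ys ⊆ xs × ws ⊆ vs × length xs ≤ 2 * length ys × length vs ≤ 2 ^ length xs * length ws ×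
     (∀ {y w} → y ∈ ys → w ∈ ws → r y w ≡ c))
monochromatic-pair xs vs r 0<vs with homogenise xs vs r
... | ws , ws⊆vs , size , const
  with nonempty ws (0<*⇒0<ʳ (2 ^ length xs) _ (≤-trans 0<vs size))
...   | w₀ , w₀∈ with majority (flip r w₀) xs
...     | ys , c , ys⊆xs , half , const-w₀ =
  ys , ws , c , ys⊆xs , ws⊆vs , half , size ,
  λ y∈ w∈ → trans (const (⊆-lookup ys⊆xs y∈) w∈ w₀∈) (const-w₀ y∈)

module _ (xs : List A) (ys : List B) (vs : List C) (r : A → C → Bool) (s : B → C → Bool)
         (0<xs : 0 < length xs) (0<ys : 0 < length ys) where

  private
    a b : ℕ
    a = length xs
    b = length ys

    -- The number of pairs (x, y) having `v` as a common neighbour.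
    degrees : C → ℕ
    degrees v = # xs (flip r v) * # ys (flip s v)

    degrees-pairs : ∀ v → degrees v ≡ ∑ xs λ x → ∑ ys λ y → 𝟙 (r x v ∧ s y v)
    degrees-pairs v = begin
      # xs (flip r v) * # ys (flip s v)              ≡⟨ ∑-*ʳ (# ys (flip s v)) xs _ ⟨
      (∑ xs λ x → 𝟙 (r x v) * # ys (flip s v))       ≡⟨ ∑-cong xs (λ x → ∑-*ˡ (𝟙 (r x v)) ys _) ⟨
      (∑ xs λ x → ∑ ys λ y → 𝟙 (r x v) * 𝟙 (s y v))  ≡⟨ ∑-cong xs (λ x → ∑-cong ys λ y → 𝟙-∧ (r x v) (s y v)) ⟨
      (∑ xs λ x → ∑ ys λ y → 𝟙 (r x v ∧ s y v))      ∎
      where open ≡-Reasoning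

    ∑-degrees : ∑ vs degrees ≡ ∑ xs λ x → ∑ ys λ y → # vs λ v → r x v ∧ s y v
    ∑-degrees = begin
      ∑ vs degrees                                          ≡⟨ ∑-cong vs degrees-pairs ⟩
      (∑ vs λ v → ∑ xs λ x → ∑ ys λ y → 𝟙 (r x v ∧ s y v))  ≡⟨ ∑-swap vs xs _ ⟩
      (∑ xs λ x → ∑ vs λ v → ∑ ys λ y → 𝟙 (r x v ∧ s y v))  ≡⟨ ∑-cong xs (λ x → ∑-swap vs ys _) ⟩
      (∑ xs λ x → ∑ ys λ y → # vs λ v → r x v ∧ s y v)      ∎
      where open ≡-Reasoning

    average-degrees : ∀ K → (∀ {x y} → x ∈ xs → y ∈ ys → length vs ≤ K * # vs (λ v → r x v ∧ s y v)) →
                      length vs * (a * b) ≤ K * ∑ vs degrees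
    average-degrees K dense = begin
      length vs * (a * b)                  ≡⟨ rotate (length vs) a b ⟩
      a * (b * length vs)                  ≡⟨ cong (a *_) (∑-const ys (length vs)) ⟨
      a * ∑ ys (λ _ → length vs)           ≡⟨ ∑-const xs _ ⟨
      (∑ xs λ _ → ∑ ys λ _ → length vs)    ≤⟨ ∑-mono xs (λ x∈ → ∑-mono ys (λ y∈ → dense x∈ y∈)) ⟩
      (∑ xs λ x → ∑ ys λ y → K * # vs λ v → r x v ∧ s y v)
                                           ≡⟨ ∑-cong xs (λ x → ∑-*ˡ K ys _) ⟩
      (∑ xs λ x → K * ∑ ys λ y → # vs λ v → r x v ∧ s y v)
                                           ≡⟨ ∑-*ˡ K xs _ ⟩
      K * (∑ xs λ x → ∑ ys λ y → # vs λ v → r x v ∧ s y v)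
                                           ≡⟨ cong (K *_) ∑-degrees ⟨
      K * ∑ vs degrees                     ∎
      where
      open ≤-Reasoning
      rotate : ∀ x y z → x * (y * z) ≡ y * (z * x)
      rotate = solve-∀

    -- A product that is a proportion 1/k of its maximum `a * b` has both factors at least that
    -- proportion of theirs.
    factor-x : ∀ k v → a * b ≤ k * degrees v → a ≤ k * # xs (flip r v)
    factor-x k v ab≤ = *-cancelʳ-≤ a _ b {{>-nonZero 0<ys}} (begin
      a * b                                     ≤⟨ ab≤ ⟩
      k * (# xs (flip r v) * # ys (flip s v))   ≤⟨ *-monoʳ-≤ k (*-monoʳ-≤ (# xs (flip r v)) (#-≤-length ys _)) ⟩
      k * (# xs (flip r v) * b)                 ≡⟨ *-assoc k _ b ⟨
      k * # xs (flip r v) * b                   ∎)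
      where open ≤-Reasoning

    factor-y : ∀ k v → a * b ≤ k * degrees v → b ≤ k * # ys (flip s v)
    factor-y k v ab≤ = *-cancelˡ-≤ a {{>-nonZero 0<xs}} (begin
      a * b                                     ≤⟨ ab≤ ⟩
      k * (# xs (flip r v) * # ys (flip s v))   ≤⟨ *-monoʳ-≤ k (*-monoˡ-≤ (# ys (flip s v)) (#-≤-length xs _)) ⟩
      k * (a * # ys (flip s v))                 ≡⟨ swap k a (# ys (flip s v)) ⟩
      a * (k * # ys (flip s v))                 ∎)
      where
      open ≤-Reasoning
      swap : ∀ x y z → x * (y * z) ≡ y * (x * z)
      swap = solve-∀

  record CommonNeighbours (k : ℕ) : Set where
    field
      xs′ : List A
      ys′ : List B
      ws  : List C
      xs′⊆xs : xs′ ⊆ xs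
      ys′⊆ys : ys′ ⊆ ys
      ws⊆vs  : ws ⊆ vs
      size-x : length xs ≤ k * length xs′
      size-y : length ys ≤ k * length ys′
      size-w : length vs ≤ k * 2 ^ (length xs + length ys) * length ws
      complete-x : ∀ {x w} → x ∈ xs′ → w ∈ ws → r x w ≡ true
      complete-y : ∀ {y w} → y ∈ ys′ → w ∈ ws → s y w ≡ true

  -- By double counting and `markov`, a proportion 1/(2K) of the vs are common neighbours of a
  -- proportion 1/(2K) of all pairs (x, y). There are at most `2 ^ (a + b)` possible traces of a
  -- vertex on `xs` and `ys`, so many of these vs share one trace, and that trace is the pair `xs′`,
  -- `ys′`.
  common-neighbours : ∀ K → 0 < length vs →
    (∀ {x y} → x ∈ xs → y ∈ ys → length vs ≤ K * # vs (λ v → r x v ∧ s y v)) →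
    CommonNeighbours (2 * K)
  common-neighbours K 0<vs dense
    with markov vs degrees (a * b) K (*-mono-≤ 0<xs 0<ys)
           (λ v → *-mono-≤ (#-≤-length xs _) (#-≤-length ys _)) (average-degrees K dense)
       | homogenise xs (select (λ v → a * b ≤ᵇ 2 * K * degrees v) vs) r
  ... | vs≤us | us′ , us′⊆us , us≤us′ , const-r with homogenise ys us′ s
  ...   | ws , ws⊆us′ , us′≤ws , const-s = record
    { xs′⊆xs = select-⊆ (flip r w₀) xs
    ; ys′⊆ys = select-⊆ (flip s w₀) ys
    ; ws⊆vs  = ⊆-trans ws⊆us (select-⊆ good vs)
    ; size-x = subst (λ m → a ≤ k * m) (sym (length-select (flip r w₀) xs)) (factor-x k w₀ ab≤)
    ; size-y = subst (λ m → b ≤ k * m) (sym (length-select (flip s w₀) ys)) (factor-y k w₀ ab≤)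
    ; size-w = size
    ; complete-x = λ x∈ w∈ →
        trans (const-r (⊆-lookup (select-⊆ (flip r w₀) xs) x∈) (⊆-lookup ws⊆us′ w∈) (⊆-lookup ws⊆us′ w₀∈))
              (∈-select⁻ (flip r w₀) xs x∈)
    ; complete-y = λ y∈ w∈ →
        trans (const-s (⊆-lookup (select-⊆ (flip s w₀) ys) y∈) w∈ w₀∈) (∈-select⁻ (flip s w₀) ys y∈)
    }
    where
    open ≤-Reasoning
    k : ℕ
    k = 2 * K
    good : C → Bool
    good v = a * b ≤ᵇ k * degrees v
    us : List C
    us = select good vs
    ws⊆us : ws ⊆ us
    ws⊆us = ⊆-trans ws⊆us′ us′⊆us
    size : length vs ≤ k * 2 ^ (a + b) * length ws
    size = begin
      length vs                              ≤⟨ vs≤us ⟩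
      k * # vs good                          ≡⟨ cong (k *_) (length-select good vs) ⟨
      k * length us                          ≤⟨ *-monoʳ-≤ k us≤us′ ⟩
      k * (2 ^ a * length us′)               ≤⟨ *-monoʳ-≤ k (*-monoʳ-≤ (2 ^ a) us′≤ws) ⟩
      k * (2 ^ a * (2 ^ b * length ws))      ≡⟨ assoc k (2 ^ a) (2 ^ b) (length ws) ⟩
      k * (2 ^ a * 2 ^ b) * length ws        ≡⟨ cong (λ p → k * p * length ws) (^-distribˡ-+-* 2 a b) ⟨
      k * 2 ^ (a + b) * length ws            ∎
      where
      assoc : ∀ x y z w → x * (y * (z * w)) ≡ x * (y * z) * w
      assoc = solve-∀
    -- All of `ws` have the same trace on `xs` and `ys`, so any element may represent it.
    w₀,∈ : ∃[ w ] w ∈ ws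
    w₀,∈ = nonempty ws (0<*⇒0<ʳ (k * 2 ^ (a + b)) _ (≤-trans 0<vs size))
    w₀ : C
    w₀ = proj₁ w₀,∈
    w₀∈ : w₀ ∈ ws
    w₀∈ = proj₂ w₀,∈
    ab≤ : a * b ≤ k * degrees w₀
    ab≤ = ≤ᵇ-true (a * b) (k * degrees w₀) (∈-select⁻ good vs (⊆-lookup ws⊆us w₀∈))

-- Monochromatic cliques

AllPairs-resp-⊆ : ∀ {A : Set} {R : Rel A 0ℓ} {xs ys : List A} → xs ⊆ ys → AllPairs R ys → AllPairs R xs
AllPairs-resp-⊆ []         []       = []
AllPairs-resp-⊆ (y ∷ʳ s)   (_ ∷ ps) = AllPairs-resp-⊆ s ps
AllPairs-resp-⊆ (refl ∷ s) (p ∷ ps) = All-resp-⊆ s p ∷ AllPairs-resp-⊆ s ps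

-- Duplicate-free lists as subsets.

toSubset : ∀ {n} → List (Fin n) → Subset n
toSubset []       = Subset.⊥
toSubset (x ∷ xs) = toSubset xs [ x ]≔ inside

module _ where
  private variable
    n : ℕ

  ∈-insert⁻ : ∀ (S : Subset n) x {y} → y Subset.∈ S [ x ]≔ inside → y ≡ x ⊎ y Subset.∈ S
  ∈-insert⁻ (_ ∷ S) zero    here       = inj₁ refl
  ∈-insert⁻ (_ ∷ S) zero    (there y∈) = inj₂ (there y∈)
  ∈-insert⁻ (_ ∷ S) (suc x) here       = inj₂ here
  ∈-insert⁻ (_ ∷ S) (suc x) (there y∈) with ∈-insert⁻ S x y∈
  ... | inj₁ refl = inj₁ refl
  ... | inj₂ y∈S  = inj₂ (there y∈S)

  ∣insert∣ : ∀ (S : Subset n) x → x Subset.∉ S → ∣ S [ x ]≔ inside ∣ ≡ suc ∣ S ∣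
  ∣insert∣ (inside  ∷ S) zero    x∉ = contradiction here x∉
  ∣insert∣ (outside ∷ S) zero    x∉ = refl
  ∣insert∣ (inside  ∷ S) (suc x) x∉ = cong suc (∣insert∣ S x (x∉ ∘ there))
  ∣insert∣ (outside ∷ S) (suc x) x∉ = ∣insert∣ S x (x∉ ∘ there)

  ∈-toSubset⁻ : ∀ (xs : List (Fin n)) {y} → y Subset.∈ toSubset xs → y ∈ xs
  ∈-toSubset⁻ []       y∈ = contradiction y∈ ∉⊥
  ∈-toSubset⁻ (x ∷ xs) y∈ with ∈-insert⁻ (toSubset xs) x y∈
  ... | inj₁ y≡x = here y≡x
  ... | inj₂ y∈S = there (∈-toSubset⁻ xs y∈S)

  ∣toSubset∣ : ∀ {xs : List (Fin n)} → Unique xs → ∣ toSubset xs ∣ ≡ length xs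
  ∣toSubset∣ {n} []      = ∣⊥∣≡0 n
  ∣toSubset∣ {xs = x ∷ xs} (x≢ ∷ xs!) = trans
    (∣insert∣ (toSubset xs) x (λ x∈ → All.lookup x≢ (∈-toSubset⁻ xs x∈) refl))
    (cong suc (∣toSubset∣ xs!))

module _ {n : ℕ} (K : Colouring n) where

  adjacent : Colour → Fin n → Fin n → Bool
  adjacent c u v = not (does (u ≟ᶠ v)) ∧ does (colour K u v ≟ᶜ c)

  adjacent-sound : ∀ c {u v} → adjacent c u v ≡ true → u ≢ v × colour K u v ≡ c
  adjacent-sound c {u} {v} adj with u ≟ᶠ v | colour K u v ≟ᶜ c
  ... | no u≢v | yes eq = u≢v , eq

  red-or-blue : ∀ {u v} → u ≢ v → 𝟙 (adjacent red u v) + 𝟙 (adjacent blue u v) ≡ 1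
  red-or-blue {u} {v} u≢v with u ≟ᶠ v | colour K u v
  ... | yes u≡v | _    = contradiction u≡v u≢v
  ... | no _    | red  = refl
  ... | no _    | blue = refl

  Clique : Colour → List (Fin n) → Set
  Clique c = AllPairs (λ u v → u ≢ v × colour K u v ≡ c)

  -- Distinctness is part of the notion, so that complete pairs yield disjoint subsets.
  Complete : Colour → List (Fin n) → List (Fin n) → Set
  Complete c xs ys = ∀ {u v} → u ∈ xs → v ∈ ys → u ≢ v × colour K u v ≡ c

  Complete-sym : ∀ {c xs ys} → Complete c xs ys → Complete c ys xs
  Complete-sym cs v∈ u∈ = ≢-sym (proj₁ (cs u∈ v∈)) , trans (symmetric K _ _) (proj₂ (cs u∈ v∈))

  -- Ramsey's theorem.

  extend-clique : ∀ c {x ys} xs → ys ⊆ select (adjacent c x) xs → Clique c ys → Clique c (x ∷ ys)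
  extend-clique c {x} xs ys⊆ ysᶜ =
    All.tabulate (λ y∈ → adjacent-sound c (∈-select⁻ (adjacent c x) xs (⊆-lookup ys⊆ y∈))) ∷ ysᶜ

  -- The power `2 ^ (a + b)` replaces the usual binomial bound: it is twice the bound for either
  -- smaller problem, so the red or the blue neighbourhood of the first vertex is large enough to
  -- recurse into.
  ramsey-offdiagonal :
    ∀ a b (xs : List (Fin n)) → Unique xs → 2 ^ (a + b) ≤ length xs →
    (∃[ ys ] (ys ⊆ xs × length ys ≡ a × Clique red ys)) ⊎
    (∃[ ys ] (ys ⊆ xs × length ys ≡ b × Clique blue ys))
  ramsey-offdiagonal zero    b       xs xs! size = inj₁ ([] , minimum xs , refl , [])
  ramsey-offdiagonal (suc a) zero    xs xs! size = inj₂ ([] , minimum xs , refl , [])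
  ramsey-offdiagonal (suc a) (suc b) [] xs! size =
    contradiction (≤-trans (m^n>0 2 (suc a + suc b)) size) λ ()
  ramsey-offdiagonal (suc a) (suc b) (x ∷ xs) (x≢ ∷ xs!) size
    with 2 ^ (a + suc b) ≤? length (select (adjacent red x) xs)
  ... | yes enough with ramsey-offdiagonal a (suc b) _ (AllPairs-resp-⊆ (select-⊆ (adjacent red x) xs) xs!) enough
  ...   | inj₁ (ys , ys⊆ , eq , ysᶜ) =
    inj₁ (x ∷ ys , refl ∷ ⊆-trans ys⊆ (select-⊆ (adjacent red x) xs) , cong suc eq , extend-clique red xs ys⊆ ysᶜ)
  ...   | inj₂ (ys , ys⊆ , eq , ysᶜ) =
    inj₂ (ys , x ∷ʳ ⊆-trans ys⊆ (select-⊆ (adjacent red x) xs) , eq , ysᶜ)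
  ramsey-offdiagonal (suc a) (suc b) (x ∷ xs) (x≢ ∷ xs!) size | no few
    with ramsey-offdiagonal (suc a) b _ (AllPairs-resp-⊆ (select-⊆ (adjacent blue x) xs) xs!) enough
    where
    open ≤-Reasoning
    r s : ℕ
    r = # xs (adjacent red x)
    s = # xs (adjacent blue x)
    split : length xs ≤ r + s
    split = begin
      length xs                                                ≡⟨ *-identityʳ (length xs) ⟨
      length xs * 1                                            ≡⟨ ∑-const xs 1 ⟨
      ∑ xs (λ _ → 1)                                           ≤⟨ ∑-mono xs (λ v∈ → ≤-reflexive (sym (red-or-blue (All.lookup x≢ v∈)))) ⟩
      ∑ xs (λ v → 𝟙 (adjacent red x v) + 𝟙 (adjacent blue x v)) ≡⟨ ∑-+ xs _ _ ⟩
      r + s                                                    ∎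
    enough : 2 ^ (suc a + b) ≤ length (select (adjacent blue x) xs)
    -- The vertex x itself is charged to the red side: the red neighbourhood misses its bound
    -- strictly, so adding x still stays within it and the blue side receives the other half.
    enough = +-cancelˡ-≤ (2 ^ (a + suc b)) _ _ (begin
      2 ^ (a + suc b) + 2 ^ (suc a + b)                     ≡⟨ cong (λ e → 2 ^ (a + suc b) + 2 ^ e) (+-suc a b) ⟨
      2 ^ (a + suc b) + 2 ^ (a + suc b)                     ≡⟨ cong (2 ^ (a + suc b) +_) (+-identityʳ _) ⟨
      2 ^ (suc a + suc b)                                   ≤⟨ size ⟩
      suc (length xs)                                       ≤⟨ s≤s split ⟩
      suc r + s                                             ≡⟨ cong₂ (λ p q → suc p + q) (length-select (adjacent red x) xs) (length-select (adjacent blue x) xs) ⟨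
      suc (length (select (adjacent red x) xs)) + length (select (adjacent blue x) xs) ≤⟨ +-monoˡ-≤ _ (≰⇒> few) ⟩
      2 ^ (a + suc b) + length (select (adjacent blue x) xs) ∎)
  ... | inj₁ (ys , ys⊆ , eq , ysᶜ) =
    inj₁ (ys , x ∷ʳ ⊆-trans ys⊆ (select-⊆ (adjacent blue x) xs) , eq , ysᶜ)
  ... | inj₂ (ys , ys⊆ , eq , ysᶜ) =
    inj₂ (x ∷ ys , refl ∷ ⊆-trans ys⊆ (select-⊆ (adjacent blue x) xs) , cong suc eq , extend-clique blue xs ys⊆ ysᶜ)

  ramsey : ∀ m (xs : List (Fin n)) → Unique xs → 2 ^ (m + m) ≤ length xs →
           ∃[ ys ] ∃[ c ] (ys ⊆ xs × length ys ≡ m × Clique c ys)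
  ramsey m xs xs! size with ramsey-offdiagonal m m xs xs! size
  ... | inj₁ (ys , clique) = ys , red , clique
  ... | inj₂ (ys , clique) = ys , blue , clique

  -- From cliques to the two patterns.

  toSubset-disjoint : ∀ {c} xs ys → Complete c xs ys → Disjoint (toSubset xs) (toSubset ys)
  toSubset-disjoint xs ys cs (v , v∈) with x∈p∩q⁻ (toSubset xs) (toSubset ys) v∈
  ... | v∈xs , v∈ys = proj₁ (cs (∈-toSubset⁻ xs v∈xs) (∈-toSubset⁻ ys v∈ys)) refl

  toSubset-between : ∀ {c} xs ys → Complete c xs ys → Between K (toSubset xs) (toSubset ys) c
  toSubset-between xs ys cs u∈ v∈ = proj₂ (cs (∈-toSubset⁻ xs u∈) (∈-toSubset⁻ ys v∈))

  clique-colour : ∀ {c xs} → Clique c xs → ∀ {u v} → u ∈ xs → v ∈ xs → u ≢ v → colour K u v ≡ c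
  clique-colour (p ∷ ps) (here refl) (here refl) u≢v = contradiction refl u≢v
  clique-colour (p ∷ ps) (here refl) (there v∈)  u≢v = proj₂ (All.lookup p v∈)
  clique-colour (p ∷ ps) (there u∈)  (here refl) u≢v = trans (symmetric K _ _) (proj₂ (All.lookup p u∈))
  clique-colour (p ∷ ps) (there u∈)  (there v∈)  u≢v = clique-colour ps u∈ v∈ u≢v

  toSubset-inside : ∀ {c} xs → Clique c xs → Inside K (toSubset xs) c
  toSubset-inside xs xsᶜ u∈ v∈ = clique-colour xsᶜ (∈-toSubset⁻ xs u∈) (∈-toSubset⁻ xs v∈)

  ∣toSubset-clique∣ : ∀ {c xs t} → Clique c xs → length xs ≡ t → ∣ toSubset xs ∣ ≡ t
  ∣toSubset-clique∣ xsᶜ refl = ∣toSubset∣ (AllPairs.map proj₁ xsᶜ)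

  record CliqueOf (t : ℕ) (c : Colour) : Set where
    constructor cliqueOf
    field
      elements : List (Fin n)
      size     : length elements ≡ t
      clique   : Clique c elements

  open CliqueOf public

  module _ {t : ℕ} where

    two-set-pattern : ∀ {c} (P Q : CliqueOf t c) → Complete (other c) (elements P) (elements Q) →
                      TwoSetPattern K t
    two-set-pattern {c} (cliqueOf ps ∣ps∣ psᶜ) (cliqueOf qs ∣qs∣ qsᶜ) PQ = record
      { A = toSubset ps
      ; B = toSubset qs
      ; ∣A∣≡t = ∣toSubset-clique∣ psᶜ ∣ps∣
      ; ∣B∣≡t = ∣toSubset-clique∣ qsᶜ ∣qs∣
      ; A-B = toSubset-disjoint ps qs PQ
      ; c = c
      ; inside-A = toSubset-inside ps psᶜ
      ; inside-B = toSubset-inside qs qsᶜ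
      ; between = toSubset-between ps qs PQ
      }

    four-set-pattern :
      (P₁ : CliqueOf t red) (P₂ P₃ : CliqueOf t blue) (P₄ : CliqueOf t red) →
      Complete blue (elements P₁) (elements P₂) → Complete red  (elements P₁) (elements P₃) →
      Complete red  (elements P₁) (elements P₄) → Complete blue (elements P₂) (elements P₃) →
      Complete red  (elements P₂) (elements P₄) → Complete blue (elements P₃) (elements P₄) →
      FourSetPattern K t
    four-set-pattern (cliqueOf ps ∣ps∣ psᶜ) (cliqueOf qs ∣qs∣ qsᶜ) (cliqueOf rs ∣rs∣ rsᶜ) (cliqueOf ss ∣ss∣ ssᶜ)
      PQ PR PS QR QS RS = record
      { V₁ = toSubset ps
      ; V₂ = toSubset qs
      ; V₃ = toSubset rs
      ; V₄ = toSubset ss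
      ; ∣V₁∣≡t = ∣toSubset-clique∣ psᶜ ∣ps∣
      ; ∣V₂∣≡t = ∣toSubset-clique∣ qsᶜ ∣qs∣
      ; ∣V₃∣≡t = ∣toSubset-clique∣ rsᶜ ∣rs∣
      ; ∣V₄∣≡t = ∣toSubset-clique∣ ssᶜ ∣ss∣
      ; disjoint₁₂ = toSubset-disjoint ps qs PQ
      ; disjoint₁₃ = toSubset-disjoint ps rs PR
      ; disjoint₁₄ = toSubset-disjoint ps ss PS
      ; disjoint₂₃ = toSubset-disjoint qs rs QR
      ; disjoint₂₄ = toSubset-disjoint qs ss QS
      ; disjoint₃₄ = toSubset-disjoint rs ss RS
      ; inside₁ = toSubset-inside ps psᶜ
      ; inside₄ = toSubset-inside ss ssᶜ
      ; between₁₃ = toSubset-between ps rs PR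
      ; between₁₄ = toSubset-between ps ss PS
      ; between₂₄ = toSubset-between qs ss QS
      ; inside₂ = toSubset-inside qs qsᶜ
      ; inside₃ = toSubset-inside rs rsᶜ
      ; between₁₂ = toSubset-between ps qs PQ
      ; between₂₃ = toSubset-between qs rs QR
      ; between₃₄ = toSubset-between rs ss RS
      }

    -- In an alternating 4-cycle X A Y B of cliques, unless two cliques of the
    -- same colour are joined in the other colour, opposite cliques have the same
    -- colour and adjacent ones have different colours.
    alternating-cycle :
      ∀ x a y b xy ab (X : CliqueOf t x) (A : CliqueOf t a) (Y : CliqueOf t y) (B : CliqueOf t b) →
      Complete red  (elements X) (elements A) → Complete blue (elements A) (elements Y) →
      Complete red  (elements Y) (elements B) → Complete blue (elements B) (elements X) →
      Complete xy   (elements X) (elements Y) → Complete ab   (elements A) (elements B) →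
      TwoSetPattern K t ⊎ FourSetPattern K t
    alternating-cycle blue blue _    _    _    _    X A Y B XA AY YB BX XY AB = inj₁ (two-set-pattern X A XA)
    alternating-cycle _    red  red  _    _    _    X A Y B XA AY YB BX XY AB = inj₁ (two-set-pattern A Y AY)
    alternating-cycle _    _    blue blue _    _    X A Y B XA AY YB BX XY AB = inj₁ (two-set-pattern Y B YB)
    alternating-cycle red  _    _    red  _    _    X A Y B XA AY YB BX XY AB = inj₁ (two-set-pattern B X BX)
    alternating-cycle red  blue red  blue blue _    X A Y B XA AY YB BX XY AB = inj₁ (two-set-pattern X Y XY)
    alternating-cycle red  blue red  blue red  red  X A Y B XA AY YB BX XY AB = inj₁ (two-set-pattern A B AB)
    -- Each diagonal now has the colour of its two cliques. The red cliques X and Y serve as V₁ and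
    -- V₄, the blue cliques B and A as V₂ and V₃; in the last clause A and B are red and take the
    -- outer places.
    alternating-cycle red  blue red  blue red  blue X A Y B XA AY YB BX XY AB =
      inj₂ (four-set-pattern X B A Y (Complete-sym BX) XA XY (Complete-sym AB) (Complete-sym YB) AY)
    alternating-cycle blue red  blue red  red  _    X A Y B XA AY YB BX XY AB = inj₁ (two-set-pattern X Y XY)
    alternating-cycle blue red  blue red  blue blue X A Y B XA AY YB BX XY AB = inj₁ (two-set-pattern A B AB)
    alternating-cycle blue red  blue red  blue red  X A Y B XA AY YB BX XY AB =
      inj₂ (four-set-pattern A Y X B AY (Complete-sym XA) AB (Complete-sym XY) YB (Complete-sym BX))

-- Twisted pairs

∑-zero : ∀ {A : Set} {m} (g : Fin m → A) (f : A → ℕ) → (∀ i → f (g i) ≡ 0) → ∑ (tabulate g) f ≡ 0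
∑-zero {m = zero}  g f f≡0 = refl
∑-zero {m = suc m} g f f≡0 = cong₂ _+_ (f≡0 zero) (∑-zero (g ∘ suc) f (f≡0 ∘ suc))

-- Needed to sum the indicator of one vertex over all vertices. An arbitrary tabulation `g` lets the
-- induction pass to `g ∘ suc`.
∑-single : ∀ {A : Set} {m} (g : Fin m → A) (f : A → ℕ) i → (∀ j → i ≢ j → f (g j) ≡ 0) →
           ∑ (tabulate g) f ≡ f (g i)
∑-single g f zero    f≡0 = trans (cong (f (g zero) +_) (∑-zero (g ∘ suc) f λ j → f≡0 (suc j) λ ()))
                                 (+-identityʳ _)
∑-single g f (suc i) f≡0 = cong₂ _+_ (f≡0 zero λ ())
  (∑-single (g ∘ suc) f i λ j i≢j → f≡0 (suc j) (i≢j ∘ suc-injective))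

below : ∀ {A : Set} → (A → ℕ) → ℕ → A → Bool
below f k x = suc (f x) ≤ᵇ k

-- A discrete intermediate value argument: nothing lies below level 0, so descending from `k` the
-- bound fails at some first level `j`. As `below` is strict, level `suc j` counts the elements with
-- `f x ≤ j`.
threshold : ∀ {A : Set} (xs : List A) f K m → 0 < m → ∀ k → m ≤ K * # xs (below f k) →
            ∃[ j ] (K * # xs (below f j) < m × m ≤ K * # xs (below f (suc j)))
threshold xs f K m 0<m zero    m≤ = contradiction
  (≤-trans 0<m (≤-trans m≤ (≤-reflexive (trans (cong (K *_) (trans (∑-const xs 0) (*-zeroʳ (length xs)))) (*-zeroʳ K)))))
  λ ()
threshold xs f K m 0<m (suc k) m≤ with m ≤? K * # xs (below f k)
... | yes m≤′ = threshold xs f K m 0<m k m≤′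
... | no  m≰  = k , ≰⇒> m≰ , m≤

module _ {n : ℕ} (K : Colouring n) where

  private
    V : List (Fin n)
    V = allFin n

  adjacent-sym : ∀ c u v → adjacent K c u v ≡ adjacent K c v u
  adjacent-sym c u v with u ≟ᶠ v | v ≟ᶠ u
  ... | yes _   | yes _   = refl
  ... | yes u≡v | no v≢u  = contradiction (sym u≡v) v≢u
  ... | no u≢v  | yes v≡u = contradiction (sym v≡u) u≢v
  ... | no _    | no _    = cong (λ d → does (d ≟ᶜ c)) (symmetric K u v)

  redDegree : Fin n → ℕ
  redDegree x = # V (adjacent K red x)

  redBlue blueRed : Fin n → Fin n → ℕ
  redBlue x y = # V λ a → adjacent K red x a ∧ adjacent K blue y a
  blueRed x y = # V λ a → adjacent K blue x a ∧ adjacent K red y a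

  -- The third terms make up for a = x and a = y.
  degree-exchange : ∀ x y a →
    𝟙 (adjacent K red x a) + 𝟙 (adjacent K blue x a ∧ adjacent K red y a) + 𝟙 (does (x ≟ᶠ a)) * 𝟙 (adjacent K red x y) ≡
    𝟙 (adjacent K red y a) + 𝟙 (adjacent K red x a ∧ adjacent K blue y a) + 𝟙 (does (y ≟ᶠ a)) * 𝟙 (adjacent K red x y)
  degree-exchange x y a with x ≟ᶠ a | y ≟ᶠ a
  ... | yes refl | yes refl = refl
  ... | yes refl | no y≢x rewrite adjacent-sym red x y with y ≟ᶠ x
  ...   | yes y≡x = contradiction y≡x y≢x
  ...   | no _ with does (colour K y x ≟ᶜ red)
  ...     | true = refl
  ...     | false = refl
  degree-exchange x y a | no x≢y | yes refl with x ≟ᶠ y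
  ... | yes x≡y = contradiction x≡y x≢y
  ... | no _ with colour K x y
  ...   | red = refl
  ...   | blue = refl
  degree-exchange x y a | no _ | no _ with colour K x a | colour K y a
  ... | red  | red  = refl
  ... | red  | blue = refl
  ... | blue | red  = refl
  ... | blue | blue = refl

  -- Two sets differ in size exactly as their two differences do. Summed over all a,
  -- `degree-exchange` says this for the red neighbourhoods; its correction terms add the same
  -- number `r` to both sides and cancel.
  redBlue≤blueRed : ∀ {x y} → redDegree x ≤ redDegree y → redBlue x y ≤ blueRed x y
  redBlue≤blueRed {x} {y} dx≤dy = +-cancelˡ-≤ (redDegree x) _ _ (+-cancelʳ-≤ r _ _ (begin
    redDegree x + redBlue x y + r   ≤⟨ +-monoˡ-≤ r (+-monoˡ-≤ (redBlue x y) dx≤dy) ⟩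
    redDegree y + redBlue x y + r   ≡⟨ cong (redDegree y + redBlue x y +_) (indicator y) ⟨
    redDegree y + redBlue x y + ∑ V (λ a → 𝟙 (does (y ≟ᶠ a)) * r)
                                    ≡⟨ ∑-+₃ _ _ _ ⟨
    ∑ V (λ a → 𝟙 (adjacent K red y a) + 𝟙 (adjacent K red x a ∧ adjacent K blue y a) + 𝟙 (does (y ≟ᶠ a)) * r)
                                    ≡⟨ ∑-cong V (degree-exchange x y) ⟨
    ∑ V (λ a → 𝟙 (adjacent K red x a) + 𝟙 (adjacent K blue x a ∧ adjacent K red y a) + 𝟙 (does (x ≟ᶠ a)) * r)
                                    ≡⟨ ∑-+₃ _ _ _ ⟩
    redDegree x + blueRed x y + ∑ V (λ a → 𝟙 (does (x ≟ᶠ a)) * r)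
                                    ≡⟨ cong (redDegree x + blueRed x y +_) (indicator x) ⟩
    redDegree x + blueRed x y + r   ∎))
    where
    open ≤-Reasoning
    r : ℕ
    r = 𝟙 (adjacent K red x y)
    ∑-+₃ : ∀ f g h → ∑ V (λ a → f a + g a + h a) ≡ ∑ V f + ∑ V g + ∑ V h
    ∑-+₃ f g h = trans (∑-+ V (λ a → f a + g a) h) (cong (_+ ∑ V h) (∑-+ V f g))
    indicator : ∀ z → ∑ V (λ a → 𝟙 (does (z ≟ᶠ a)) * r) ≡ r
    indicator z = trans (∑-single (λ i → i) _ z off) on
      where
      off : ∀ j → z ≢ j → 𝟙 (does (z ≟ᶠ j)) * r ≡ 0
      off j z≢j with z ≟ᶠ j
      ... | yes z≡j = contradiction z≡j z≢j
      ... | no _    = refl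
      on : 𝟙 (does (z ≟ᶠ z)) * r ≡ r
      on with z ≟ᶠ z
      ... | yes _  = +-identityʳ r
      ... | no z≢z = contradiction refl z≢z

  -- Twisted pairs across a degree threshold, with an integer `E` in the role of 1/ε.

  module _ (E : ℕ) (0<n : 0 < length V)
           (balanced : ∀ c v → length V ≤ E * # V (adjacent K c v)) where

    private
      N : ℕ
      N = length V

    1≤E : 1 ≤ E
    1≤E = 0<*⇒0<ʳ (redDegree v) E (subst (0 <_) (*-comm E _) (≤-trans 0<n (balanced red v)))
      where
      v : Fin n
      v = proj₁ (nonempty V 0<n)

    -- j is chosen so that about n / 2E vertices have red degree at most j.
    degree-threshold : ∃[ j ] (2 * E * # V (below redDegree j) < N ×
                               N ≤ 2 * E * # V (below redDegree (suc j)))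
    degree-threshold = threshold V redDegree (2 * E) N 0<n (suc N) (begin
      N                                     ≡⟨ *-identityʳ N ⟨
      N * 1                                 ≡⟨ ∑-const V 1 ⟨
      ∑ V (λ _ → 1)                         ≡⟨ ∑-cong V all-below ⟩
      # V (below redDegree (suc N))         ≡⟨ *-identityˡ _ ⟨
      1 * # V (below redDegree (suc N))     ≤⟨ *-monoˡ-≤ _ (≤-trans 1≤E (m≤m+n E _)) ⟩
      2 * E * # V (below redDegree (suc N)) ∎)
      where
      open ≤-Reasoning
      all-below : ∀ x → 1 ≡ 𝟙 (below redDegree (suc N) x)
      all-below x with below redDegree (suc N) x in eq
      ... | true  = refl
      ... | false = contradiction (≤ᵇ-false (suc (redDegree x)) (suc N) eq) (≤⇒≯ (s≤s (#-≤-length V _)))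

    module _ (j : ℕ) (few-below : 2 * E * # V (below redDegree j) < N) where

      private
        high : Fin n → Bool
        high = not ∘ below redDegree j

        k₁ : ℕ
        k₁ = E * (2 * E)

        weight : Fin n → Fin n → ℕ
        weight x y = 𝟙 (high y) * redBlue x y

      -- Of the at least N/E blue neighbours of a, fewer than N/(2E) have red degree below `j`.
      high-blue-neighbours : ∀ a → N ≤ 2 * E * # V (λ y → high y ∧ adjacent K blue y a)
      high-blue-neighbours a = +-cancelʳ-≤ N _ _ (begin
        N + N                                  ≡⟨ cong (N +_) (+-identityʳ N) ⟨
        2 * N                                  ≤⟨ *-monoʳ-≤ 2 (balanced blue a) ⟩
        2 * (E * # V (adjacent K blue a))      ≡⟨ *-assoc 2 E _ ⟨
        2 * E * # V (adjacent K blue a)        ≤⟨ *-monoʳ-≤ (2 * E) split ⟩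
        2 * E * (h + l)                        ≡⟨ *-distribˡ-+ (2 * E) h l ⟩
        2 * E * h + 2 * E * l                  ≤⟨ +-monoʳ-≤ (2 * E * h) (<⇒≤ few-below) ⟩
        2 * E * h + N                          ∎)
        where
        open ≤-Reasoning
        h l : ℕ
        h = # V (λ y → high y ∧ adjacent K blue y a)
        l = # V (below redDegree j)
        pointwise : ∀ y → 𝟙 (adjacent K blue a y) ≤ 𝟙 (high y ∧ adjacent K blue y a) + 𝟙 (below redDegree j y)
        pointwise y rewrite adjacent-sym blue a y with below redDegree j y
        ... | true  = 𝟙≤1 _
        ... | false = m≤m+n _ 0
        split : # V (adjacent K blue a) ≤ h + l
        split = ≤-trans (∑-mono V (λ {y} _ → pointwise y)) (≤-reflexive (∑-+ V _ _))

      -- The sum counts paths from x along a red edge to some a and on along a blue edge to a high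
      -- y. There are at least N/E choices for a and then at least N/(2E) for y.
      total-weight : ∀ x → N * N ≤ k₁ * ∑ V (weight x)
      total-weight x = begin
        N * N                                   ≤⟨ *-monoˡ-≤ N (balanced red x) ⟩
        E * # V (adjacent K red x) * N          ≡⟨ *-assoc E _ N ⟩
        E * (# V (adjacent K red x) * N)        ≡⟨ cong (E *_) (∑-*ʳ N V _) ⟨
        E * ∑ V (λ a → 𝟙 (adjacent K red x a) * N)
          ≤⟨ *-monoʳ-≤ E (∑-mono V λ {a} _ → *-monoʳ-≤ (𝟙 (adjacent K red x a)) (high-blue-neighbours a)) ⟩
        E * ∑ V (λ a → 𝟙 (adjacent K red x a) * (2 * E * # V (λ y → high y ∧ adjacent K blue y a)))
          ≡⟨ cong (E *_) (∑-cong V λ a → swap (𝟙 (adjacent K red x a)) (2 * E) _) ⟩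
        E * ∑ V (λ a → 2 * E * (𝟙 (adjacent K red x a) * # V (λ y → high y ∧ adjacent K blue y a)))
          ≡⟨ cong (E *_) (∑-*ˡ (2 * E) V _) ⟩
        E * (2 * E * ∑ V (λ a → 𝟙 (adjacent K red x a) * # V (λ y → high y ∧ adjacent K blue y a)))
          ≡⟨ *-assoc E (2 * E) _ ⟨
        k₁ * ∑ V (λ a → 𝟙 (adjacent K red x a) * # V (λ y → high y ∧ adjacent K blue y a))
          ≡⟨ cong (k₁ *_) (∑-cong V λ a → ∑-*ˡ (𝟙 (adjacent K red x a)) V _) ⟨
        k₁ * ∑ V (λ a → ∑ V λ y → 𝟙 (adjacent K red x a) * 𝟙 (high y ∧ adjacent K blue y a))
          ≡⟨ cong (k₁ *_) (∑-swap V V _) ⟩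
        k₁ * ∑ V (λ y → ∑ V λ a → 𝟙 (adjacent K red x a) * 𝟙 (high y ∧ adjacent K blue y a))
          ≡⟨ cong (k₁ *_) (∑-cong V λ y → ∑-cong V λ a → rearrange (adjacent K red x a) (high y) (adjacent K blue y a)) ⟩
        k₁ * ∑ V (λ y → ∑ V λ a → 𝟙 (high y) * 𝟙 (adjacent K red x a ∧ adjacent K blue y a))
          ≡⟨ cong (k₁ *_) (∑-cong V λ y → ∑-*ˡ (𝟙 (high y)) V _) ⟩
        k₁ * ∑ V (weight x) ∎
        where
        open ≤-Reasoning
        swap : ∀ a b c → a * (b * c) ≡ b * (a * c)
        swap = solve-∀
        rearrange : ∀ p q r → 𝟙 p * 𝟙 (q ∧ r) ≡ 𝟙 q * 𝟙 (p ∧ r)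
        rearrange true  q r = trans (+-identityʳ _) (𝟙-∧ q r)
        rearrange false q r = sym (*-zeroʳ (𝟙 q))

      private
        k₂ : ℕ
        k₂ = 2 * k₁

      -- A vertex y of red degree below `j` has weight 0 and fails the test, as N is positive; so
      -- the test also certifies that y is high.
      richlyJoined : Fin n → Fin n → Bool
      richlyJoined x y = N ≤ᵇ k₂ * weight x y

      many-richlyJoined : ∀ x → N ≤ k₂ * # V (richlyJoined x)
      many-richlyJoined x = markov V (weight x) N k₁ 0<n weight≤N (total-weight x)
        where
        weight≤N : ∀ y → weight x y ≤ N
        weight≤N y = ≤-trans (*-mono-≤ (𝟙≤1 (high y)) (#-≤-length V _)) (≤-reflexive (+-identityʳ N))

      -- The red degree of x is at most `j` and that of y at least `j`, so `redBlue≤blueRed` carries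
      -- the lower bound over to the second difference.
      richlyJoined-sound : ∀ {x y} → below redDegree (suc j) x ≡ true → richlyJoined x y ≡ true →
                           N ≤ k₂ * redBlue x y × N ≤ k₂ * blueRed x y
      richlyJoined-sound {x} {y} x-low rich with below redDegree j y in eq | ≤ᵇ-true N _ rich
      ... | true  | N≤0 = contradiction (≤-trans 0<n (≤-trans N≤0 (≤-reflexive (*-zeroʳ k₂)))) λ ()
      ... | false | N≤w = N≤rb , ≤-trans N≤rb (*-monoʳ-≤ k₂ (redBlue≤blueRed dx≤dy))
        where
        N≤rb : N ≤ k₂ * redBlue x y
        N≤rb = subst (λ w → N ≤ k₂ * w) (+-identityʳ _) N≤w
        dx≤dy : redDegree x ≤ redDegree y
        dx≤dy = ≤-trans (s≤s⁻¹ (≤ᵇ-true (suc (redDegree x)) (suc j) x-low))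
                        (s≤s⁻¹ (≤ᵇ-false (suc (redDegree y)) j eq))

-- From twisted cliques to an alternating 4-cycle

n<2^n : ∀ n → n < 2 ^ n
n<2^n zero    = z<s
n<2^n (suc n) = begin-strict
  suc n           ≡⟨ +-comm 1 n ⟩
  n + 1           <⟨ +-mono-<-≤ (n<2^n n) (≤-trans (m^n>0 2 n) (m≤m+n (2 ^ n) 0)) ⟩
  2 ^ suc n       ∎
  where open ≤-Reasoning

*-≤-2^ : ∀ {c d} a b → c ≤ 2 ^ a → d ≤ 2 ^ b → c * d ≤ 2 ^ (a + b)
*-≤-2^ a b c≤ d≤ = ≤-trans (*-mono-≤ c≤ d≤) (≤-reflexive (sym (^-distribˡ-+-* 2 a b)))

module _ {n : ℕ} (K : Colouring n) where

  private
    V : List (Fin n)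
    V = allFin n

  colourOf : Bool → Colour
  colourOf true  = red
  colourOf false = blue

  colourOf-red : ∀ c → c ≡ colourOf (does (c ≟ᶜ red))
  colourOf-red red  = refl
  colourOf-red blue = refl

  shrink-clique : ∀ {c t zs} → Clique K c zs → t ≤ length zs → CliqueOf K t c
  shrink-clique {t = t} {zs} zsᶜ t≤ =
    cliqueOf (take t zs) (trans (length-take t zs) (m≤n⇒m⊓n≡m t≤)) (AllPairs-resp-⊆ (take-⊆ t zs) zsᶜ)

  module _ (E : ℕ) (0<n : 0 < length V)
           (balanced : ∀ c v → length V ≤ E * # V (adjacent K c v)) where

    private
      -- For twisted pairs both differences have size at least N/k₂, where `k₂` is 4E². The factor
      -- that `common-neighbours` then loses is `κ`, that is 8E².
      N k₂ κ : ℕ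
      N  = length V
      k₂ = 2 * (E * (2 * E))
      κ  = 2 * k₂

      0<E : 0 < E
      0<E = 1≤E K E 0<n balanced

      2E≤κ : 2 * E ≤ κ
      2E≤κ = begin
        2 * E              ≤⟨ m≤m*n (2 * E) (4 * E) {{>-nonZero (*-mono-≤ {1} {4} (s≤s z≤n) 0<E)}} ⟩
        2 * E * (4 * E)    ≡⟨ identity E ⟩
        κ                  ∎
        where
        open ≤-Reasoning
        identity : ∀ x → 2 * x * (4 * x) ≡ 2 * (2 * (x * (2 * x)))
        identity = solve-∀

    -- In the bound on `xs` the factor `κ` is lost to common neighbours and the factor 2 to making
    -- the colour between the cliques constant. `joined` speaks of colours only; distinctness
    -- follows later from a third vertex.
    record TwistedCliques (M : ℕ) : Set where
      field
        xs ys       : List (Fin n)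
        x y xy      : Colour
        xs-clique   : Clique K x xs
        ys-clique   : Clique K y ys
        ∣xs∣≤M      : length xs ≤ M
        M≤∣xs∣      : M ≤ κ * (2 * length xs)
        ∣ys∣≡M      : length ys ≡ M
        joined      : ∀ {u v} → u ∈ xs → v ∈ ys → colour K u v ≡ xy
        red-blue    : ∀ {u v} → u ∈ xs → v ∈ ys → N ≤ k₂ * redBlue K u v
        blue-red    : ∀ {u v} → u ∈ xs → v ∈ ys → N ≤ k₂ * blueRed K u v

    module _ (M : ℕ) (1≤M : 1 ≤ M) (κ≤2^M : κ ≤ 2 ^ M) (N-large : 2 ^ (7 * M) ≤ N) where

      private
        -- Splits the exponent 7M: 5M absorbs the loss factor `c`, and 2M remains for Ramsey's
        -- theorem.
        large : ∀ {c} e (zs : List (Fin n)) → e ≤ 5 * M → c ≤ 2 ^ e → N ≤ c * length zs →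
                2 ^ (M + M) ≤ length zs
        large {c} e zs e≤ c≤ N≤ = *-cancelˡ-≤ (2 ^ (5 * M)) {{m^n≢0 2 (5 * M)}} (begin
          2 ^ (5 * M) * 2 ^ (M + M)   ≡⟨ ^-distribˡ-+-* 2 (5 * M) (M + M) ⟨
          2 ^ (5 * M + (M + M))       ≡⟨ cong (2 ^_) (seven M) ⟩
          2 ^ (7 * M)                 ≤⟨ N-large ⟩
          N                           ≤⟨ N≤ ⟩
          c * length zs               ≤⟨ *-monoˡ-≤ (length zs) (≤-trans c≤ (^-monoʳ-≤ 2 e≤)) ⟩
          2 ^ (5 * M) * length zs     ∎)
          where
          open ≤-Reasoning
          seven : ∀ m → 5 * m + (m + m) ≡ 7 * m
          seven = solve-∀

      -- Ramsey's theorem among vertices of low red degree gives `xs₀`. Every member is richly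
      -- joined to many vertices, so a large part `xs₁` is richly joined to all of a large set `vs`.
      -- Once the colour between the two is made constant, Ramsey's theorem inside the second set
      -- gives `ys`.
      twisted-cliques : TwistedCliques M
      twisted-cliques with degree-threshold K E 0<n balanced
      ... | j , few-below , many-below
        with ramsey K M (select (below (redDegree K) (suc j)) V)
               (AllPairs-resp-⊆ (select-⊆ (below (redDegree K) (suc j)) V) (allFin⁺ n))
               (large M (select (below (redDegree K) (suc j)) V) (m≤m+n M (4 * M)) (≤-trans 2E≤κ κ≤2^M)
                 (subst (λ l → N ≤ 2 * E * l) (sym (length-select (below (redDegree K) (suc j)) V)) many-below))
      ...   | xs₀ , x , xs₀⊆low , refl , xs₀-clique
        -- A dummy first side with one element turns the two-sided lemma into a one-sided one; it
        -- accounts for `suc M` in the exponents below.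
        with common-neighbours (tt ∷ []) xs₀ V (λ _ _ → true) (richlyJoined K E 0<n balanced j few-below)
               z<s 1≤M k₂ 0<n (λ {_} {u} _ _ → many-richlyJoined K E 0<n balanced j few-below u)
      ...     | record { ys′ = xs₁ ; ws = vs ; ys′⊆ys = xs₁⊆xs₀ ; ws⊆vs = vs⊆V ; size-y = xs₀≤xs₁
                       ; size-w = N≤vs ; complete-y = rich }
        with monochromatic-pair xs₁ vs (λ u v → does (colour K u v ≟ᶜ red))
               (0<*⇒0<ʳ (κ * 2 ^ suc M) _ (≤-trans 0<n N≤vs))
      ...       | xs , vs′ , c , xs⊆xs₁ , vs′⊆vs , xs₁≤xs , vs≤vs′ , mono
        with ramsey K M vs′ (AllPairs-resp-⊆ (⊆-trans vs′⊆vs vs⊆V) (allFin⁺ n))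
               (large (M + suc M + M) vs′ exponent
                 (*-≤-2^ (M + suc M) M (*-≤-2^ M (suc M) κ≤2^M ≤-refl) (^-monoʳ-≤ 2 (length-mono-≤ xs₁⊆xs₀)))
                 (begin
                   N                                                    ≤⟨ N≤vs ⟩
                   κ * 2 ^ suc M * length vs                            ≤⟨ *-monoʳ-≤ (κ * 2 ^ suc M) vs≤vs′ ⟩
                   κ * 2 ^ suc M * (2 ^ length xs₁ * length vs′)        ≡⟨ *-assoc (κ * 2 ^ suc M) _ _ ⟨
                   κ * 2 ^ suc M * 2 ^ length xs₁ * length vs′          ∎))
        where
        open ≤-Reasoning
        exponent : M + suc M + M ≤ 5 * M
        exponent = begin
          M + suc M + M       ≤⟨ +-monoˡ-≤ M (+-monoʳ-≤ M (+-monoˡ-≤ M 1≤M)) ⟩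
          M + (M + M) + M     ≤⟨ m≤m+n _ M ⟩
          M + (M + M) + M + M ≡⟨ five M ⟩
          5 * M               ∎
          where
          five : ∀ m → m + (m + m) + m + m ≡ 5 * m
          five = solve-∀
      ...         | ys , y , ys⊆vs′ , ∣ys∣ , ys-clique = record
        { xs = xs
        ; ys = ys
        ; xs-clique = AllPairs-resp-⊆ xs⊆xs₀ xs₀-clique
        ; ys-clique = ys-clique
        ; ∣xs∣≤M = length-mono-≤ xs⊆xs₀
        ; M≤∣xs∣ = ≤-trans xs₀≤xs₁ (*-monoʳ-≤ κ xs₁≤xs)
        ; ∣ys∣≡M = ∣ys∣
        ; joined = λ {u} {v} u∈ v∈ →
            trans (colourOf-red (colour K u v)) (cong colourOf (mono u∈ (⊆-lookup ys⊆vs′ v∈)))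
        ; red-blue = λ u∈ v∈ → proj₁ (twisted u∈ v∈)
        ; blue-red = λ u∈ v∈ → proj₂ (twisted u∈ v∈)
        }
        where
        xs⊆xs₀ : xs ⊆ xs₀
        xs⊆xs₀ = ⊆-trans xs⊆xs₁ xs₁⊆xs₀
        twisted : ∀ {u v} → u ∈ xs → v ∈ ys → N ≤ k₂ * redBlue K u v × N ≤ k₂ * blueRed K u v
        twisted u∈ v∈ = richlyJoined-sound K E 0<n balanced j few-below
          (∈-select⁻ (below (redDegree K) (suc j)) V (⊆-lookup xs₀⊆low (⊆-lookup xs⊆xs₀ u∈)))
          (rich (⊆-lookup xs⊆xs₁ u∈) (⊆-lookup (⊆-trans ys⊆vs′ vs′⊆vs) v∈))

      module _ (t : ℕ) (M≡ : M ≡ κ * (2 * (κ * κ)) * t) (T : TwistedCliques M) where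

        open TwistedCliques T

        private
          -- The loss along X: 2κ in building the twisted cliques, then κ in each of two
          -- applications of `common-neighbours`. The losses along Y, A and B are κ², 2 and 1, all
          -- at most `D`.
          D : ℕ
          D = κ * (2 * (κ * κ))

          1≤κ : 1 ≤ κ
          1≤κ = ≤-trans (*-mono-≤ {1} {2} (s≤s z≤n) 0<E) 2E≤κ

          instance
            κ≢0 : NonZero κ
            κ≢0 = >-nonZero 1≤κ

            D≢0 : NonZero D
            D≢0 = >-nonZero (*-mono-≤ 1≤κ (*-mono-≤ {1} {2} (s≤s z≤n) (*-mono-≤ 1≤κ 1≤κ)))

          enough : ∀ {c} (zs : List (Fin n)) → c ≤ D → M ≤ c * length zs → t ≤ length zs
          enough {c} zs c≤D M≤ = *-cancelˡ-≤ D (≤-trans (≤-reflexive (sym M≡)) (≤-trans M≤ (*-monoˡ-≤ (length zs) c≤D)))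

          2≤D : 2 ≤ D
          2≤D = *-mono-≤ 1≤κ (*-mono-≤ {2} {2} ≤-refl (*-mono-≤ 1≤κ 1≤κ))

          κκ≤D : κ * κ ≤ D
          κκ≤D = ≤-trans (m≤m+n (κ * κ) (1 * (κ * κ))) (m≤n*m (2 * (κ * κ)) κ)

          0<∣xs∣ : 0 < length xs
          0<∣xs∣ = 0<*⇒0<ʳ 2 (length xs) (0<*⇒0<ʳ κ (2 * length xs) (≤-trans 1≤M M≤∣xs∣))

          0<∣ys∣ : 0 < length ys
          0<∣ys∣ = subst (0 <_) (sym ∣ys∣≡M) 1≤M

          5M : ∀ m → m + (m + m) + m + m ≡ 5 * m
          5M = solve-∀

        -- One difference of the twisted pairs yields `as`, red to X and blue to Y. The pairs that
        -- survive are still twisted, and the other difference yields `bs`, blue to X and red to Y.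
        -- Ramsey's theorem makes both into cliques, and in between the colour across the diagonal
        -- A, B is made constant.
        alternating-cycle-exists : TwoSetPattern K t ⊎ FourSetPattern K t
        alternating-cycle-exists
          with common-neighbours xs ys V (adjacent K red) (adjacent K blue) 0<∣xs∣ 0<∣ys∣ k₂ 0<n red-blue
        ... | record { xs′ = xs₁ ; ys′ = ys₁ ; ws = as ; xs′⊆xs = xs₁⊆xs ; ys′⊆ys = ys₁⊆ys ; ws⊆vs = as⊆V
                     ; size-x = xs≤xs₁ ; size-y = ys≤ys₁ ; size-w = N≤as
                     ; complete-x = xs₁-as ; complete-y = ys₁-as }
          with common-neighbours xs₁ ys₁ V (adjacent K blue) (adjacent K red)
                 (0<*⇒0<ʳ κ (length xs₁) (≤-trans 0<∣xs∣ xs≤xs₁)) (0<*⇒0<ʳ κ (length ys₁) (≤-trans 0<∣ys∣ ys≤ys₁))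
                 k₂ 0<n (λ u∈ v∈ → blue-red (⊆-lookup xs₁⊆xs u∈) (⊆-lookup ys₁⊆ys v∈))
             | ramsey K M as (AllPairs-resp-⊆ as⊆V (allFin⁺ n))
                 (large (M + (M + M)) as (≤-trans (≤-trans (m≤m+n _ M) (m≤m+n _ M)) (≤-reflexive (5M M)))
                   (*-≤-2^ M (M + M) κ≤2^M (^-monoʳ-≤ 2 (+-mono-≤ ∣xs∣≤M (≤-reflexive ∣ys∣≡M)))) N≤as)
        ... | record { xs′ = xs₂ ; ys′ = ys₂ ; ws = bs ; xs′⊆xs = xs₂⊆xs₁ ; ys′⊆ys = ys₂⊆ys₁ ; ws⊆vs = bs⊆V
                     ; size-x = xs₁≤xs₂ ; size-y = ys₁≤ys₂ ; size-w = N≤bs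
                     ; complete-x = xs₂-bs ; complete-y = ys₂-bs }
            | as₀ , a , as₀⊆as , ∣as₀∣ , as₀-clique
          with monochromatic-pair as₀ bs (λ u v → does (colour K u v ≟ᶜ red))
                 (0<*⇒0<ʳ (κ * 2 ^ (length xs₁ + length ys₁)) (length bs) (≤-trans 0<n N≤bs))
        ... | as₁ , bs₁ , c , as₁⊆as₀ , bs₁⊆bs , as₀≤as₁ , bs≤bs₁ , mono
          with ramsey K M bs₁ (AllPairs-resp-⊆ (⊆-trans bs₁⊆bs bs⊆V) (allFin⁺ n))
                 -- The summands pay for `κ`, for the traces on `xs₁` and `ys₁`, and for those on
                 -- `as₀`.
                 (large (M + (M + M) + M) bs₁ (≤-trans (m≤m+n _ M) (≤-reflexive (5M M)))
                   (*-≤-2^ (M + (M + M)) M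
                     (*-≤-2^ M (M + M) κ≤2^M (^-monoʳ-≤ 2 (+-mono-≤
                       (≤-trans (length-mono-≤ xs₁⊆xs) ∣xs∣≤M)
                       (≤-trans (length-mono-≤ ys₁⊆ys) (≤-reflexive ∣ys∣≡M)))))
                     (^-monoʳ-≤ 2 (≤-reflexive ∣as₀∣)))
                   (begin
                     N                                                     ≤⟨ N≤bs ⟩
                     κ * 2 ^ (length xs₁ + length ys₁) * length bs         ≤⟨ *-monoʳ-≤ (κ * 2 ^ (length xs₁ + length ys₁)) bs≤bs₁ ⟩
                     κ * 2 ^ (length xs₁ + length ys₁) * (2 ^ length as₀ * length bs₁)
                                                                           ≡⟨ *-assoc (κ * 2 ^ (length xs₁ + length ys₁)) _ _ ⟨
                     κ * 2 ^ (length xs₁ + length ys₁) * 2 ^ length as₀ * length bs₁ ∎))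
          where open ≤-Reasoning
        ... | bs₂ , b , bs₂⊆bs₁ , ∣bs₂∣ , bs₂-clique =
          alternating-cycle K x a y b xy (colourOf c)
            (shrink-clique (AllPairs-resp-⊆ xs₂⊆xs xs-clique) t≤xs₂)
            (shrink-clique (AllPairs-resp-⊆ as₁⊆as₀ as₀-clique) t≤as₁)
            (shrink-clique (AllPairs-resp-⊆ ys₂⊆ys ys-clique) t≤ys₂)
            (shrink-clique bs₂-clique t≤bs₂)
            (shrink-complete red xs₂ as₁ xs₂-as₁)
            (shrink-complete blue as₁ ys₂ (Complete-sym K ys₂-as₁))
            (shrink-complete red ys₂ bs₂ ys₂-bs₂)
            (shrink-complete blue bs₂ xs₂ (Complete-sym K xs₂-bs₂))
            (shrink-complete xy xs₂ ys₂ xs₂-ys₂)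
            (shrink-complete (colourOf c) as₁ bs₂ as₁-bs₂)
          where
          open ≤-Reasoning

          xs₂⊆xs : xs₂ ⊆ xs
          xs₂⊆xs = ⊆-trans xs₂⊆xs₁ xs₁⊆xs
          ys₂⊆ys : ys₂ ⊆ ys
          ys₂⊆ys = ⊆-trans ys₂⊆ys₁ ys₁⊆ys
          as₁⊆as : as₁ ⊆ as
          as₁⊆as = ⊆-trans as₁⊆as₀ as₀⊆as
          bs₂⊆bs : bs₂ ⊆ bs
          bs₂⊆bs = ⊆-trans bs₂⊆bs₁ bs₁⊆bs

          t≤xs₂ : t ≤ length xs₂
          t≤xs₂ = enough xs₂ ≤-refl (begin
            M                                       ≤⟨ M≤∣xs∣ ⟩
            κ * (2 * length xs)                     ≤⟨ *-monoʳ-≤ κ (*-monoʳ-≤ 2 xs≤xs₁) ⟩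
            κ * (2 * (κ * length xs₁))              ≤⟨ *-monoʳ-≤ κ (*-monoʳ-≤ 2 (*-monoʳ-≤ κ xs₁≤xs₂)) ⟩
            κ * (2 * (κ * (κ * length xs₂)))        ≡⟨ assoc κ (length xs₂) ⟩
            κ * (2 * (κ * κ)) * length xs₂          ∎)
            where
            assoc : ∀ p q → p * (2 * (p * (p * q))) ≡ p * (2 * (p * p)) * q
            assoc = solve-∀
          t≤ys₂ : t ≤ length ys₂
          t≤ys₂ = enough ys₂ κκ≤D (begin
            M                          ≡⟨ ∣ys∣≡M ⟨
            length ys                  ≤⟨ ys≤ys₁ ⟩
            κ * length ys₁             ≤⟨ *-monoʳ-≤ κ ys₁≤ys₂ ⟩
            κ * (κ * length ys₂)       ≡⟨ *-assoc κ κ _ ⟨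
            κ * κ * length ys₂         ∎)
          t≤as₁ : t ≤ length as₁
          t≤as₁ = enough as₁ 2≤D (≤-trans (≤-reflexive (sym ∣as₀∣)) as₀≤as₁)
          t≤bs₂ : t ≤ length bs₂
          t≤bs₂ = enough {1} bs₂ (≤-trans (s≤s z≤n) 2≤D)
            (≤-reflexive (trans (sym ∣bs₂∣) (sym (*-identityˡ (length bs₂)))))

          xs₂-as₁ : Complete K red xs₂ as₁
          xs₂-as₁ u∈ v∈ = adjacent-sound K red (xs₁-as (⊆-lookup xs₂⊆xs₁ u∈) (⊆-lookup as₁⊆as v∈))
          ys₂-as₁ : Complete K blue ys₂ as₁
          ys₂-as₁ u∈ v∈ = adjacent-sound K blue (ys₁-as (⊆-lookup ys₂⊆ys₁ u∈) (⊆-lookup as₁⊆as v∈))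
          xs₂-bs₂ : Complete K blue xs₂ bs₂
          xs₂-bs₂ u∈ v∈ = adjacent-sound K blue (xs₂-bs u∈ (⊆-lookup bs₂⊆bs v∈))
          ys₂-bs₂ : Complete K red ys₂ bs₂
          ys₂-bs₂ u∈ v∈ = adjacent-sound K red (ys₂-bs u∈ (⊆-lookup bs₂⊆bs v∈))

          -- Opposite cliques are disjoint because a vertex of a neighbouring clique sees one in red
          -- and the other in blue; such a vertex exists as t is positive.
          distinct : ∀ {u v w} → colour K w u ≡ red → colour K w v ≡ blue → u ≢ v
          distinct w-u w-v refl = contradiction (trans (sym w-u) w-v) λ ()

          0<t : 0 < t
          0<t = 0<*⇒0<ʳ D t (subst (0 <_) M≡ 1≤M)
          xs₂-ys₂ : Complete K xy xs₂ ys₂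
          xs₂-ys₂ u∈ v∈ with nonempty as₁ (≤-trans 0<t t≤as₁)
          ... | w , w∈ =
            distinct (proj₂ (Complete-sym K xs₂-as₁ w∈ u∈)) (proj₂ (Complete-sym K ys₂-as₁ w∈ v∈)) ,
            joined (⊆-lookup xs₂⊆xs u∈) (⊆-lookup ys₂⊆ys v∈)
          as₁-bs₂ : Complete K (colourOf c) as₁ bs₂
          as₁-bs₂ {u} {v} u∈ v∈ with nonempty xs₂ (≤-trans 0<t t≤xs₂)
          ... | w , w∈ =
            distinct (proj₂ (xs₂-as₁ w∈ u∈)) (proj₂ (xs₂-bs₂ w∈ v∈)) ,
            trans (colourOf-red (colour K u v)) (cong colourOf (mono u∈ (⊆-lookup bs₂⊆bs₁ v∈)))

          shrink-complete : ∀ d ps qs → Complete K d ps qs → Complete K d (take t ps) (take t qs)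
          shrink-complete d ps qs pq u∈ v∈ = pq (⊆-lookup (take-⊆ t ps) u∈) (⊆-lookup (take-⊆ t qs) v∈)

    pattern-exists : ∀ t b → 1 ≤ t → 7168 ≤ b → 2 ^ (b * (E ^ 6 * t)) ≤ N → TwoSetPattern K t ⊎ FourSetPattern K t
    pattern-exists t b 1≤t 7168≤b size =
      alternating-cycle-exists M 1≤M κ≤2^M N-large t refl (twisted-cliques M 1≤M κ≤2^M N-large)
      where
      open ≤-Reasoning
      M : ℕ
      M = κ * (2 * (κ * κ)) * t
      1≤κ : 1 ≤ κ
      1≤κ = ≤-trans (*-mono-≤ {1} {2} (s≤s z≤n) 0<E) 2E≤κ
      1≤2κκ : 1 ≤ 2 * (κ * κ)
      1≤2κκ = *-mono-≤ {1} {2} (s≤s z≤n) (*-mono-≤ 1≤κ 1≤κ)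
      1≤M : 1 ≤ M
      1≤M = *-mono-≤ (*-mono-≤ 1≤κ 1≤2κκ) 1≤t
      κ≤2^M : κ ≤ 2 ^ M
      κ≤2^M = begin
        κ                        ≤⟨ m≤m*n κ (2 * (κ * κ)) {{>-nonZero 1≤2κκ}} ⟩
        κ * (2 * (κ * κ))        ≤⟨ m≤m*n _ t {{>-nonZero 1≤t}} ⟩
        M                        <⟨ n<2^n M ⟩
        2 ^ M                    ∎
      N-large : 2 ^ (7 * M) ≤ N
      N-large = ≤-trans (^-monoʳ-≤ 2 (≤-trans (≤-reflexive (expand E t)) (*-monoˡ-≤ (E ^ 6 * t) 7168≤b))) size
        where
        -- As `κ` is 8E² and M is 2κ³t, 7M equals 7 * 2 * 8³ * E⁶ * t, which explains 7168.
        κ≡ : ∀ e → 2 * (2 * (e * (2 * e))) ≡ 8 * (e * e)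
        κ≡ = solve-∀
        cube : ∀ c q s → 7 * (c * q * (2 * (c * q * (c * q))) * s) ≡ 7 * (2 * (c * c * c)) * (q * q * q * s)
        cube = solve-∀
        sixth : ∀ e s → e * e * (e * e) * (e * e) * s ≡ e * (e * (e * (e * (e * (e * 1))))) * s
        sixth = solve-∀
        expand : ∀ e s → let k = 2 * (2 * (e * (2 * e))) in 7 * (k * (2 * (k * k)) * s) ≡ 7168 * (e ^ 6 * s)
        expand e s rewrite κ≡ e = trans (cube 8 (e * e) s) (cong (7168 *_) (sixth e s))

-- Rational and real bounds

-- The denominator is given by its predecessor, as in `mkℚᵘ`; comparisons and products are
-- transferred to unnormalised rationals, where they are integer arithmetic.
fraction : ℕ → ℕ → ℚ
fraction a k = ℤ.+ a ℚ./ suc k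

fraction-≤ : ∀ a k b l → a * suc l ≤ b * suc k → fraction a k ℚ.≤ fraction b l
fraction-≤ a k b l al≤bk = ℚ.toℚᵘ-cancel-≤
  (ℚᵘ.≤-respˡ-≃ (ℚᵘ.≃-sym (ℚ.toℚᵘ-fromℚᵘ (mkℚᵘ (ℤ.+ a) k)))
    (ℚᵘ.≤-respʳ-≃ (ℚᵘ.≃-sym (ℚ.toℚᵘ-fromℚᵘ (mkℚᵘ (ℤ.+ b) l)))
      (*≤* (subst₂ ℤ._≤_ (ℤ.pos-* a (suc l)) (ℤ.pos-* b (suc k)) (ℤ.+≤+ al≤bk)))))

fraction-≤⁻ : ∀ a k b l → fraction a k ℚ.≤ fraction b l → a * suc l ≤ b * suc k
fraction-≤⁻ a k b l ≤ℚ
  with ℚᵘ.≤-respˡ-≃ (ℚ.toℚᵘ-fromℚᵘ (mkℚᵘ (ℤ.+ a) k))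
         (ℚᵘ.≤-respʳ-≃ (ℚ.toℚᵘ-fromℚᵘ (mkℚᵘ (ℤ.+ b) l)) (ℚ.toℚᵘ-mono-≤ ≤ℚ))
... | *≤* ≤ℤ = ℤ.drop‿+≤+ (subst₂ ℤ._≤_ (sym (ℤ.pos-* a (suc l))) (sym (ℤ.pos-* b (suc k))) ≤ℤ)

fraction-< : ∀ a k b l → a * suc l < b * suc k → fraction a k ℚ.< fraction b l
fraction-< a k b l al<bk = ℚ.≰⇒> λ b≤a → <⇒≱ al<bk (fraction-≤⁻ b l a k b≤a)

-- The index on the right is the predecessor of `suc k * suc l`.
fraction-* : ∀ a k b l → fraction a k ℚ.* fraction b l ≡ fraction (a * b) (l + k * suc l)
fraction-* a k b l = ℚ.toℚᵘ-injective (begin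
  ℚ.toℚᵘ (fraction a k ℚ.* fraction b l)                ≈⟨ ℚ.toℚᵘ-homo-* (fraction a k) (fraction b l) ⟩
  ℚ.toℚᵘ (fraction a k) ℚᵘ.* ℚ.toℚᵘ (fraction b l)      ≈⟨ ℚᵘ.*-cong (ℚ.toℚᵘ-fromℚᵘ (mkℚᵘ (ℤ.+ a) k)) (ℚ.toℚᵘ-fromℚᵘ (mkℚᵘ (ℤ.+ b) l)) ⟩
  mkℚᵘ (ℤ.+ a ℤ.* ℤ.+ b) (l + k * suc l)                    ≡⟨ cong (λ i → mkℚᵘ i (l + k * suc l)) (ℤ.pos-* a b) ⟨
  mkℚᵘ (ℤ.+ (a * b)) (l + k * suc l)                      ≈⟨ ℚ.toℚᵘ-fromℚᵘ (mkℚᵘ (ℤ.+ (a * b)) (l + k * suc l)) ⟨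
  ℚ.toℚᵘ (fraction (a * b) (l + k * suc l))             ∎)
  where open import Relation.Binary.Reasoning.Setoid ℚᵘ.≃-setoid

fromℕ-* : ∀ m n → fromℕ (m * n) ≡ fromℕ m ℚ.* fromℕ n
fromℕ-* m n = sym (fraction-* m 0 n 0)

fromℕ-^ : ∀ m k → fromℕ (m ^ k) ≡ fromℕ m ^ℚ k
fromℕ-^ m zero    = refl
fromℕ-^ m (suc k) = trans (fromℕ-* m (m ^ k)) (cong (fromℕ m ℚ.*_) (fromℕ-^ m k))

0≤fraction : ∀ a k → 0ℚ ℚ.≤ fraction a k
0≤fraction a k = fraction-≤ 0 0 a k z≤n

*-mono-≤ℚ : ∀ {p q r s} → 0ℚ ℚ.≤ p → 0ℚ ℚ.≤ s → p ℚ.≤ q → r ℚ.≤ s → p ℚ.* r ℚ.≤ q ℚ.* s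
*-mono-≤ℚ {p} {q} {r} {s} 0≤p 0≤s p≤q r≤s =
  ℚ.≤-trans (ℚ.*-monoˡ-≤-nonNeg p {{ℚ.nonNegative 0≤p}} r≤s) (ℚ.*-monoʳ-≤-nonNeg s {{ℚ.nonNegative 0≤s}} p≤q)

0≤* : ∀ {p q} → 0ℚ ℚ.≤ p → 0ℚ ℚ.≤ q → 0ℚ ℚ.≤ p ℚ.* q
0≤* {p} {q} 0≤p 0≤q = ℚ.≤-trans (ℚ.≤-reflexive (sym (ℚ.*-zeroˡ 0ℚ))) (*-mono-≤ℚ ℚ.≤-refl 0≤q 0≤p 0≤q)

0≤^ : ∀ {p} m → 0ℚ ℚ.≤ p → 0ℚ ℚ.≤ p ^ℚ m
0≤^ zero    0≤p = 0≤fraction 1 0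
0≤^ (suc m) 0≤p = 0≤* 0≤p (0≤^ m 0≤p)

^-monoˡ-≤ℚ : ∀ {p q} m → 0ℚ ℚ.≤ p → p ℚ.≤ q → p ^ℚ m ℚ.≤ q ^ℚ m
^-monoˡ-≤ℚ zero    0≤p p≤q = ℚ.≤-refl
^-monoˡ-≤ℚ (suc m) 0≤p p≤q = *-mono-≤ℚ 0≤p (0≤^ m (ℚ.≤-trans 0≤p p≤q)) p≤q (^-monoˡ-≤ℚ m 0≤p p≤q)

-- Dedekind reals and integer reciprocals.

p<p+1 : ∀ p → p ℚ.< p ℚ.+ 1ℚ
p<p+1 p = subst (ℚ._< p ℚ.+ 1ℚ) (ℚ.+-identityʳ p) (ℚ.+-monoʳ-< p (ℚ.positive⁻¹ 1ℚ))

fromℚ : ℚ → ℝ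
fromℚ q = record
  { lower = ℚ._< q
  ; upper = q ℚ.<_
  ; lower-inhabited = q ℚ.- 1ℚ , below-q
  ; upper-inhabited = q ℚ.+ 1ℚ , p<p+1 q
  ; lower-rounded = λ p → mk⇔ ℚ.<-dense λ (r , p<r , r<q) → ℚ.<-trans p<r r<q
  ; upper-rounded = λ p → mk⇔ (λ q<p → let r , q<r , r<p = ℚ.<-dense q<p in r , r<p , q<r)
                              λ (r , r<p , q<r) → ℚ.<-trans q<r r<p
  ; disjoint = λ p (p<q , q<p) → ℚ.<-asym p<q q<p
  ; located = located-q
  }
  where
  below-q : q ℚ.- 1ℚ ℚ.< q
  below-q = subst (q ℚ.- 1ℚ ℚ.<_) (ℚ.+-identityʳ q) (ℚ.+-monoʳ-< q (ℚ.negative⁻¹ (ℚ.- 1ℚ)))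
  located-q : ∀ p r → p ℚ.< r → p ℚ.< q ⊎ q ℚ.< r
  located-q p r p<r with p ℚ.<? q
  ... | yes p<q = inj₁ p<q
  ... | no  p≮q = inj₂ (ℚ.≤-<-trans (ℚ.≮⇒≥ p≮q) p<r)

lower-< : ∀ x {p q} → p ℚ.< q → lower x q → lower x p
lower-< x p<q q<x = Equivalence.from (lower-rounded x _) (_ , p<q , q<x)

unit-fraction-< : ∀ r .{{_ : ℚ.Positive r}} → ∃[ k ] fraction 1 k ℚ.< r
unit-fraction-< r@(mkℚ (ℤ.+ suc p) d _) = suc d ,
  subst (fraction 1 (suc d) ℚ.<_) (ℚ.↥p/↧p≡p r) (fraction-< 1 (suc d) (suc p) d (begin-strict
    1 * suc d                ≡⟨ *-identityˡ (suc d) ⟩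
    suc d                    <⟨ n<1+n (suc d) ⟩
    suc (suc d)              ≤⟨ m≤n*m (suc (suc d)) (suc p) ⟩
    suc p * suc (suc d)      ∎))
  where open ≤-Reasoning

positive-fraction : ∀ x → Positive x → ∃[ k ] lower x (fraction 1 k)
positive-fraction x 0<x with Equivalence.to (lower-rounded x 0ℚ) 0<x
... | r , 0<r , r<x with unit-fraction-< r {{ℚ.positive 0<r}}
...   | k , k<r = k , lower-< x k<r r<x

-- The positive integer suc k equals 1 / x up to a factor of 4.
record Reciprocal (x : ℝ) : Set where
  field
    k       : ℕ
    lower-x : lower x (fraction 1 k)
    e       : ℚ
    0≤e     : 0ℚ ℚ.≤ e
    upper-x : upper x e
    ke≤4    : fromℕ (suc k) ℚ.* e ℚ.≤ fromℕ 4

-- Real comparison is undecidable, so locatedness is applied to 1/(k+1) and 2/(k+1). Either the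
-- lower bound improves and the descent continues, or x lies between 1/(k+2) and 2/(k+1), whose
-- ratio is at most 4.
reciprocal : ∀ x k → lower x (fraction 1 k) → lower x (fraction 1 0) ⊎ Reciprocal x
reciprocal x zero    1<x = inj₁ 1<x
reciprocal x (suc k) lx with located x (fraction 1 k) (fraction 2 k) (fraction-< 1 k 2 k (*-monoˡ-< (suc k) {1} {2} (s≤s (s≤s z≤n))))
... | inj₁ lx′ = reciprocal x k lx′
... | inj₂ ux  = inj₂ record
  { k       = suc k
  ; lower-x = lx
  ; e       = fraction 2 k
  ; 0≤e     = 0≤fraction 2 k
  ; upper-x = ux
  ; ke≤4    = subst (ℚ._≤ fromℕ 4) (sym (fraction-* (2 + k) 0 2 k))
                (fraction-≤ ((2 + k) * 2) (k + 0) 4 0 (begin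
                  (2 + k) * 2 * 1             ≤⟨ m≤m+n _ (2 * k) ⟩
                  (2 + k) * 2 * 1 + 2 * k     ≡⟨ identity k ⟩
                  4 * suc (k + 0)             ∎))
  }
  where
  open ≤-Reasoning
  identity : ∀ m → (2 + m) * 2 * 1 + 2 * m ≡ 4 * suc (m + 0)
  identity = solve-∀

-- Local balance in natural numbers.

length-filter : ∀ {A : Set} {P : A → Set} (P? : Decidable P) xs →
                length (filter P? xs) ≡ # xs (does ∘ P?)
length-filter P? []       = refl
length-filter P? (x ∷ xs) with does (P? x)
... | true  = cong suc (length-filter P? xs)
... | false = length-filter P? xs

module _ {n : ℕ} (K : Colouring n) (x : ℝ) (balanced : LocallyBalanced K x) where

  degree-≥ : ∀ k → lower x (fraction 1 k) → ∀ c v →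
             length (allFin n) ≤ suc k * # (allFin n) (adjacent K c v)
  degree-≥ k lx c v = begin
    length (allFin n)                     ≡⟨ length-tabulate {n = n} (λ i → i) ⟩
    n                                     ≡⟨ trans (*-identityʳ _) (*-identityˡ n) ⟨
    1 * n * 1                             ≤⟨ fraction-≤⁻ (1 * n) (0 + k * 1) (degree K c v) 0 (subst (ℚ._≤ fromℕ (degree K c v)) (fraction-* 1 k n 0) (balanced v c _ lx)) ⟩
    degree K c v * suc (0 + k * 1)        ≡⟨ *-comm (degree K c v) _ ⟩
    -- The decision procedure in `degree` computes to `adjacent`.
    suc (k * 1) * degree K c v            ≡⟨ cong₂ (λ a b → suc a * b) (*-identityʳ k) (length-filter _ (allFin n)) ⟩
    suc k * # (allFin n) (adjacent K c v) ∎
    where open ≤-Reasoning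

  -- The two degrees of a vertex add up to at most n, so they cannot both reach a positive n.
  balance<1 : 0 < n → ¬ lower x (fraction 1 0)
  balance<1 0<n 1<x = <-irrefl refl (begin-strict
    # (allFin n) (adjacent K red v)                                    <⟨ m<m+n _ 0<blue ⟩
    # (allFin n) (adjacent K red v) + # (allFin n) (adjacent K blue v) ≡⟨ ∑-+ (allFin n) _ _ ⟨
    ∑ (allFin n) (λ u → 𝟙 (adjacent K red v u) + 𝟙 (adjacent K blue v u))
                                                                       ≤⟨ ∑-mono (allFin n) (λ {u} _ → at-most-one u) ⟩
    ∑ (allFin n) (λ _ → 1)                                             ≡⟨ trans (∑-const (allFin n) 1) (*-identityʳ _) ⟩
    length (allFin n)                                                  ≤⟨ degree-≥ 0 1<x red v ⟩
    1 * # (allFin n) (adjacent K red v)                                ≡⟨ *-identityˡ _ ⟩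
    # (allFin n) (adjacent K red v)                                    ∎)
    where
    open ≤-Reasoning
    0<length : 0 < length (allFin n)
    0<length = subst (0 <_) (sym (length-tabulate {n = n} (λ i → i))) 0<n
    v : Fin n
    v = proj₁ (nonempty (allFin n) 0<length)
    0<blue : 0 < # (allFin n) (adjacent K blue v)
    0<blue = 0<*⇒0<ʳ 1 _ (≤-trans 0<length (degree-≥ 0 1<x blue v))
    at-most-one : ∀ u → 𝟙 (adjacent K red v u) + 𝟙 (adjacent K blue v u) ≤ 1
    at-most-one u with v ≟ᶠ u | colour K v u
    ... | yes _ | _    = z≤n
    ... | no _  | red  = ≤-refl
    ... | no _  | blue = ≤-refl

-- With division cleared, this places the integer exponent `b * t * E ^ m` below C t / e^m for C
-- slightly above b f^m.
below-cut : ∀ m b t E e f → 0ℚ ℚ.≤ e → fromℕ E ℚ.* e ℚ.≤ f →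
            fromℕ (b * t * E ^ m) ℚ.* e ^ℚ m ℚ.≤ (fromℕ b ℚ.* f ^ℚ m) ℚ.* fromℕ t
below-cut m b t E e f 0≤e Ee≤f = begin
  fromℕ (b * t * E ^ m) ℚ.* e ^ℚ m                         ≡⟨ cong (ℚ._* e ^ℚ m) (fromℕ-* (b * t) (E ^ m)) ⟩
  fromℕ (b * t) ℚ.* fromℕ (E ^ m) ℚ.* e ^ℚ m               ≡⟨ cong (λ p → fromℕ (b * t) ℚ.* p ℚ.* e ^ℚ m) (fromℕ-^ E m) ⟩
  fromℕ (b * t) ℚ.* fromℕ E ^ℚ m ℚ.* e ^ℚ m                ≡⟨ ℚ.*-assoc (fromℕ (b * t)) _ _ ⟩
  fromℕ (b * t) ℚ.* (fromℕ E ^ℚ m ℚ.* e ^ℚ m)              ≡⟨ cong (fromℕ (b * t) ℚ.*_) (^-distrib-* (fromℕ E) e m) ⟨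
  fromℕ (b * t) ℚ.* (fromℕ E ℚ.* e) ^ℚ m                   ≤⟨ ℚ.*-monoˡ-≤-nonNeg (fromℕ (b * t)) {{ℚ.nonNegative (0≤fraction (b * t) 0)}} (^-monoˡ-≤ℚ m (0≤* (0≤fraction E 0) 0≤e) Ee≤f) ⟩
  fromℕ (b * t) ℚ.* f ^ℚ m                                 ≡⟨ cong (ℚ._* f ^ℚ m) (fromℕ-* b t) ⟩
  fromℕ b ℚ.* fromℕ t ℚ.* f ^ℚ m                           ≡⟨ ℚ.*-assoc (fromℕ b) _ _ ⟩
  fromℕ b ℚ.* (fromℕ t ℚ.* f ^ℚ m)                         ≡⟨ cong (fromℕ b ℚ.*_) (ℚ.*-comm (fromℕ t) (f ^ℚ m)) ⟩
  fromℕ b ℚ.* (f ^ℚ m ℚ.* fromℕ t)                         ≡⟨ ℚ.*-assoc (fromℕ b) _ _ ⟨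
  fromℕ b ℚ.* f ^ℚ m ℚ.* fromℕ t                           ∎
  where open ℚ.≤-Reasoning

0<fromℕ : ∀ {t} → 1 ≤ t → 0ℚ ℚ.< fromℕ t
0<fromℕ {t} 1≤t = fraction-< 0 0 t 0 (*-monoˡ-< 1 1≤t)

module _ (b : ℕ) (7168≤b : 7168 ≤ b) (c₀ : ℚ) (0≤c₀ : 0ℚ ℚ.≤ c₀)
         (c₀-large : ∀ t E e → 0ℚ ℚ.≤ e → fromℕ E ℚ.* e ℚ.≤ fromℕ 4 →
                     fromℕ (b * t * E ^ 16) ℚ.* e ^ℚ 16 ℚ.≤ c₀ ℚ.* fromℕ t) where

  private
    -- Room for two strict inequalities: `c₂` is the constant C, `c₁` lies in its lower cut, and
    -- `c₀ < c₁` makes the bound on the exponent strict.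
    c₁ c₂ : ℚ
    c₁ = c₀ ℚ.+ 1ℚ
    c₂ = c₁ ℚ.+ 1ℚ

  0<c₂ : Positive (fromℚ c₂)
  0<c₂ = ℚ.≤-<-trans 0≤c₀ (ℚ.<-trans (p<p+1 c₀) (p<p+1 c₁))

  c₀t<c₁t : ∀ {t} → 1 ≤ t → c₀ ℚ.* fromℕ t ℚ.< c₁ ℚ.* fromℕ t
  c₀t<c₁t {t} 1≤t = ℚ.*-monoˡ-<-pos (fromℕ t) {{ℚ.positive (0<fromℕ 1≤t)}} (p<p+1 c₀)

  module _ (ε : ℝ) (t : ℕ) (1≤t : 1 ≤ t) (n : ℕ) (n-large : 2^ Ct/ε¹⁶ (fromℚ c₂) t ε ≤ n) where

    0<n : 0 < n
    -- The fraction 0/1 lies in the cut, which gives 2^0 ≤ n.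
    0<n = subst (1 ≤_) (*-identityʳ n) (n-large 0 1
      (c₁ , proj₁ (upper-inhabited ε) , p<p+1 c₁ , proj₂ (upper-inhabited ε) ,
       ℚ.≤-<-trans (ℚ.≤-trans (ℚ.≤-reflexive (ℚ.*-zeroˡ (proj₁ (upper-inhabited ε) ^ℚ 16))) (0≤* 0≤c₀ (0≤fraction t 0))) (c₀t<c₁t 1≤t)))

    2^≤n : ∀ E e → 0ℚ ℚ.≤ e → upper ε e → fromℕ E ℚ.* e ℚ.≤ fromℕ 4 → 2 ^ (b * t * E ^ 16) ≤ n
    2^≤n E e 0≤e ε<e Ee≤4 = subst (2 ^ (b * t * E ^ 16) ≤_) (*-identityʳ n)
      (n-large (b * t * E ^ 16) 1
        (c₁ , e , p<p+1 c₁ , ε<e , ℚ.≤-<-trans (c₀-large t E e 0≤e Ee≤4) (c₀t<c₁t 1≤t)))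

    -- Passes from the sixth power in `pattern-exists` to the sixteenth in the hypothesis on n.
    exponent-≤ : ∀ E .{{_ : NonZero E}} → b * (E ^ 6 * t) ≤ b * t * E ^ 16
    exponent-≤ E = begin
      b * (E ^ 6 * t)      ≤⟨ *-monoʳ-≤ b (*-monoˡ-≤ t (^-monoʳ-≤ E (m≤m+n 6 10))) ⟩
      b * (E ^ 16 * t)     ≡⟨ cong (b *_) (*-comm (E ^ 16) t) ⟩
      b * (t * E ^ 16)     ≡⟨ *-assoc b t _ ⟨
      b * t * E ^ 16       ∎
      where open ≤-Reasoning

    module _ (K : Colouring n) (balanced : LocallyBalanced K ε) where

      pattern-from-reciprocal : Reciprocal ε → TwoSetPattern K t ⊎ FourSetPattern K t
      pattern-from-reciprocal R =
        pattern-exists K (suc k) (subst (0 <_) (sym ∣V∣) 0<n) (degree-≥ K ε balanced k lower-x) t b 1≤t 7168≤b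
          (subst (2 ^ (b * (suc k ^ 6 * t)) ≤_) (sym ∣V∣)
            (≤-trans (^-monoʳ-≤ 2 (exponent-≤ (suc k))) (2^≤n (suc k) e 0≤e upper-x ke≤4)))
        where
        open Reciprocal R
        ∣V∣ : length (allFin n) ≡ n
        ∣V∣ = length-tabulate {n = n} (λ i → i)

      pattern-exists-ℝ : Positive ε → TwoSetPattern K t ⊎ FourSetPattern K t
      pattern-exists-ℝ 0<ε =
        [ (λ 1<ε → contradiction 1<ε (balance<1 K ε balanced 0<n)) , pattern-from-reciprocal ]′
          (reciprocal ε (proj₁ (positive-fraction ε 0<ε)) (proj₂ (positive-fraction ε 0<ε)))

theorem1p4 : ∃[ C ] (Positive C ×
    (∀ (ε : ℝ) → Positive ε →
    ∀ (t : ℕ) → 1 ≤ t →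
    ∀ (n : ℕ) → 2^ Ct/ε¹⁶ C t ε ≤ n →
    ∀ (K : Colouring n) → LocallyBalanced K ε →
    TwoSetPattern K t ⊎ FourSetPattern K t))
theorem1p4 = fromℚ (c₀ ℚ.+ 1ℚ ℚ.+ 1ℚ) , 0<c₂ 7168 ≤-refl c₀ 0≤c₀ c₀-large , λ ε 0<ε t 1≤t n n-large K balanced →
  pattern-exists-ℝ 7168 ≤-refl c₀ 0≤c₀ c₀-large ε t 1≤t n n-large K balanced 0<ε
  where
  c₀ : ℚ
  -- The factor 4^16 pays for replacing 1/ε by an integer that is accurate up to a factor of 4.
  c₀ = fromℕ 7168 ℚ.* fromℕ 4 ^ℚ 16
  0≤c₀ : 0ℚ ℚ.≤ c₀
  0≤c₀ = 0≤* (0≤fraction 7168 0) (0≤^ 16 (0≤fraction 4 0))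
  c₀-large : ∀ t E e → 0ℚ ℚ.≤ e → fromℕ E ℚ.* e ℚ.≤ fromℕ 4 →
             fromℕ (7168 * t * E ^ 16) ℚ.* e ^ℚ 16 ℚ.≤ c₀ ℚ.* fromℕ t
  c₀-large t E e = below-cut 16 7168 t E e (fromℕ 4)
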